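{- For every nonnegative integer $n$, $$\overline{A}_{125}(25n)\equiv \overline{A}_{125}(625n) \pmod{5}.$$
   Context: An overpartition of $n$ is a partition of $n$ in which the first occurrence of each distinct part may be overlined. For a positive integer $\ell$, $\overline{A}_\ell(n)$ denotes the number of overpartitions of $n$ into parts not divisible by $\ell$, with $\overline{A}_\ell(0)=1$; equivalently $$\sum_{n\ge 0}\overline{A}_\ell(n)q^n=\frac{(q^\ell;q^\ell)_\infty^2(q^2;q^2)_\infty}{(q;q)_\infty^2(q^{2\ell};q^{2\ell})_\infty},\qquad (a;q)_\infty=\prod_{k\ge 0}(1-aq^k).$$ -}

module Defs where

open import Data.Nat using (ℕ; zero; suc; _+_; _*_; _∸_; _≤?_; NonZero)
open import Data.Nat.Divisibility using (_∣?_)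
open import Data.Bool using (Bool; true; false)
open import Data.List using (List; []; _∷_; _++_; map; concatMap; length; upTo)
open import Data.Product using (_×_; _,_)
open import Relation.Nullary using (yes; no)

-- An overpartition is represented by the list of its distinct part sizes,
-- each with its multiplicity (≥ 1) and a flag saying whether the first
-- occurrence of that part is overlined.
-- Entry (k , m , b) : part size k occurs m times; b = true iff overlined.
Overpartition : Set
Overpartition = List (ℕ × ℕ × Bool)

-- All overpartitions of r whose parts are among 1..k and not divisible by ℓ,
-- listed with part sizes in decreasing order (so each overpartition appears
-- exactly once).  For the largest allowed size k we choose a multiplicity
-- m ∈ {0,…,r} with m*k ≤ r and, if m ≥ 1, an overline flag.
overpartsUpTo : (ℓ : ℕ) → ℕ → ℕ → List Overpartition
overpartsUpTo ℓ zero zero = [] ∷ []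
overpartsUpTo ℓ zero (suc r) = []
overpartsUpTo ℓ (suc k) r with ℓ ∣? suc k
... | yes _ = overpartsUpTo ℓ k r
... | no _ = overpartsUpTo ℓ k r ++ concatMap withMult (upTo r)
  where
  withMult : ℕ → List Overpartition
  withMult j with suc j * suc k ≤? r
  ... | no _ = []
  ... | yes _ =
    map ((suc k , suc j , true) ∷_) (overpartsUpTo ℓ k (r ∸ suc j * suc k))
    ++ map ((suc k , suc j , false) ∷_) (overpartsUpTo ℓ k (r ∸ suc j * suc k))

-- Ā_ℓ(n): number of overpartitions of n into parts not divisible by ℓ
-- (parts of an overpartition of n are at most n).  Ā_ℓ(0) = 1.
Abar : ℕ → ℕ → ℕ
Abar ℓ n = length (overpartsUpTo ℓ n n)

{-# OPTIONS --safe #-}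
module Submission where

-- Over F₅ the fifth power of a series f(q) is f(q⁵).  Let φ = Σ (-q)^(x²) over x ∈ ℤ.
-- Gauss's identity φ = Π (1 - qʲ) / (1 + qʲ) turns the generating function of Ā₁₂₅
-- into φ(q¹²⁵) / φ(q) = φ¹²⁴.  Let U send Σ a(n) qⁿ to Σ a(5n) qⁿ, so that U(x⁵ y) = x U(y).
-- Multiplication by 2 + i and 2 - i on the Gaussian integers gives U(φ²) = 2 φ² - φ(q⁵)².
-- Since squares are 0, 1 or 4 modulo 5, φ = α⁵ + q B⁵ + q⁴ C⁵ with α = U(φ) = φ⁵, and the
-- formula for U(φ²) becomes q B C = φ² - α².  Expanding powers of φ, this yields
-- U(φ⁴) = φ⁴ and U(φ⁸) = φ⁸.  Therefore U²(φ¹²⁴) = φ¹² and U(φ¹²) = φ² U(φ²) = 2 φ⁴ - φ¹²,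
-- so U² fixes φ¹² = U²(φ¹²⁴).

open import Defs
open import Level using (0ℓ)
open import Algebra using (CommutativeRing; RawRing)
open import Algebra.Solver.Ring.AlmostCommutativeRing
  using (fromCommutativeRing; Induced-equivalence; _-Raw-AlmostCommutative⟶_)
import Algebra.Solver.Ring as RingSolver
open import Data.Bool using (Bool; true; false)
open import Data.Fin using (Fin; toℕ; zero; suc)
open import Data.Fin.Patterns
open import Data.Fin.Properties using (_≟_; all?; toℕ-fromℕ<; toℕ<n)
open import Data.Integer as ℤ using (ℤ; +_; -[1+_]; ∣_∣)
import Data.Integer.Divisibility.Signed as ℤ
import Data.Integer.Properties as ℤ
open import Data.Integer.Solver using (module +-*-Solver)
open import Data.List
  using (List; []; _∷_; _++_; length; map; filter; cartesianProduct; concatMap; applyUpTo)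
open import Data.List.Membership.Propositional using (_∈_)
open import Data.List.Membership.Propositional.Properties
  using (∈-map⁺; ∈-map⁻; ∈-filter⁺; ∈-filter⁻; ∈-cartesianProduct⁺)
open import Data.List.Membership.Propositional.Properties.WithK using (unique∧set⇒bag)
open import Data.List.Properties using (length-map; length-++; filter-accept; filter-reject)
open import Data.List.Relation.Binary.BagAndSetEquality using (∼bag⇒↭)
open import Data.List.Relation.Binary.Permutation.Propositional.Properties using (↭-length)
open import Data.List.Relation.Unary.All as All using (All; []; _∷_)
open import Data.List.Relation.Unary.AllPairs using ([]; _∷_)
open import Data.List.Relation.Unary.Any using (here; there)
open import Data.List.Relation.Unary.Unique.Propositional using (Unique)
import Data.List.Relation.Unary.Unique.Propositional.Properties as Unique
import Data.Maybe as Maybe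
open import Data.Nat as ℕ using (ℕ; zero; suc)
open import Data.Nat.Divisibility
  using (_∣_; _∣?_; divides; n∣m*n; ∣m+n∣m⇒∣n; >⇒∤; *-cancelʳ-∣)
import Data.Nat.DivMod as ℕ
open import Data.Nat.Primality using (Prime; prime?; euclidsLemma)
import Data.Nat.Properties as ℕ
import Data.Nat.Solver as ℕ-Solver
open import Data.Product using (∃; _×_; _,_; proj₁; proj₂)
open import Data.Sum using (inj₁; inj₂; [_,_]′)
open import Function using (_∘_; id; mk⇔)
open import Relation.Binary.PropositionalEquality as ≡ using (_≡_; _≢_; _≗_)
open import Relation.Nullary using (¬_; Dec; yes; no; contradiction)
open import Relation.Nullary.Decidable using (from-yes; dec⇒maybe; ¬?; _×-dec_)
open import Relation.Binary.Definitions using (WeaklyDecidable)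
open import Relation.Unary using (Decidable)

-- In base 5 every digit of 124 = 4·25 + 4·5 + 4 is 4, so U strips one digit at a time: U(φ¹²⁴) =
-- φ²⁴ U(φ⁴) = φ²⁸ = (φ⁴)⁵ φ⁸, and then U(φ²⁸) = φ⁴ U(φ⁸). The two values U(φ⁴) and U(φ⁸) can be
-- computed because B and C enter them only through q B C, known from U(φ²), and q B⁵ + q⁴ C⁵, which
-- is φ - α⁵ by the dissection of φ. The main obstacle is the infinite product. No limit of products
-- is ever formed: Gauss's identity is proved for products up to n with an error divisible by qⁿ⁺¹,
-- denominators are multiplied out, and the resulting common factor, a series with constant term 1,
-- is cancelled coefficient by coefficient. The algebra is carried out in an arbitrary commutative
-- ring receiving F₅, with q and U as parameters. There a polynomial identity in characteristic 5 is
-- a normalisation with coefficients in F₅.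

-- The field with five elements

F₅ : Set
F₅ = Fin 5

infixl 6 _⊕_
infixl 7 _⊗_
infix  8 ⊖_

_⊕_ _⊗_ : F₅ → F₅ → F₅
x ⊕ y = (toℕ x ℕ.+ toℕ y) ℕ.mod 5
x ⊗ y = (toℕ x ℕ.* toℕ y) ℕ.mod 5

⊖_ : F₅ → F₅
⊖ x = 4F ⊗ x

⊕-assoc : ∀ x y z → (x ⊕ y) ⊕ z ≡ x ⊕ (y ⊕ z)
⊕-assoc = from-yes (all? λ x → all? λ y → all? λ z → (x ⊕ y) ⊕ z ≟ x ⊕ (y ⊕ z))

⊗-assoc : ∀ x y z → (x ⊗ y) ⊗ z ≡ x ⊗ (y ⊗ z)
⊗-assoc = from-yes (all? λ x → all? λ y → all? λ z → (x ⊗ y) ⊗ z ≟ x ⊗ (y ⊗ z))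

⊗-distribˡ-⊕ : ∀ x y z → x ⊗ (y ⊕ z) ≡ x ⊗ y ⊕ x ⊗ z
⊗-distribˡ-⊕ = from-yes (all? λ x → all? λ y → all? λ z → x ⊗ (y ⊕ z) ≟ x ⊗ y ⊕ x ⊗ z)

⊕-comm : ∀ x y → x ⊕ y ≡ y ⊕ x
⊕-comm = from-yes (all? λ x → all? λ y → x ⊕ y ≟ y ⊕ x)

⊗-comm : ∀ x y → x ⊗ y ≡ y ⊗ x
⊗-comm = from-yes (all? λ x → all? λ y → x ⊗ y ≟ y ⊗ x)

⊕-identityˡ : ∀ x → 0F ⊕ x ≡ x
⊕-identityˡ = from-yes (all? λ x → 0F ⊕ x ≟ x)

⊗-identityˡ : ∀ x → 1F ⊗ x ≡ x
⊗-identityˡ = from-yes (all? λ x → 1F ⊗ x ≟ x)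

⊖-inverseˡ : ∀ x → ⊖ x ⊕ x ≡ 0F
⊖-inverseˡ = from-yes (all? λ x → ⊖ x ⊕ x ≟ 0F)

F₅-rawRing : RawRing 0ℓ 0ℓ
F₅-rawRing = record { Carrier = F₅ ; _≈_ = _≡_ ; _+_ = _⊕_ ; _*_ = _⊗_ ; -_ = ⊖_ ; 0# = 0F ; 1# = 1F }

-- Frobenius and 125th powers in an algebra over F₅

module F₅Algebra {a ℓ} (R : CommutativeRing a ℓ)
                 (ι : F₅-rawRing -Raw-AlmostCommutative⟶ fromCommutativeRing R) where

  open CommutativeRing R hiding (zero)
  open import Algebra.Properties.Semiring.Exp semiring
  open import Algebra.Properties.CommutativeSemiring.Exp commutativeSemiring using (^-distrib-*)
  open import Relation.Binary.Reasoning.Setoid setoid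
  open _-Raw-AlmostCommutative⟶_ ι using (⟦_⟧)
  private
    ⟦_≟_⟧ : WeaklyDecidable (Induced-equivalence ι)
    ⟦ c ≟ d ⟧ = Maybe.map (λ c≡d → reflexive (≡.cong ⟦_⟧ c≡d)) (dec⇒maybe (c ≟ d))
    module Solver = RingSolver F₅-rawRing (fromCommutativeRing R) ι ⟦_≟_⟧
  open Solver using (solve; _:=_; _:+_; _:*_; _:-_; _:^_; con)

  -- The solver's coefficients lie in F₅, so the binomial coefficients 5 and 10 vanish during
  -- normalisation.
  frobenius-+ : ∀ x y → (x + y) ^ 5 ≈ x ^ 5 + y ^ 5
  frobenius-+ = solve 2 (λ x y → (x :+ y) :^ 5 := x :^ 5 :+ y :^ 5) refl

  frobenius-* : ∀ x y → (x * y) ^ 5 ≈ x ^ 5 * y ^ 5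
  frobenius-* = solve 2 (λ x y → (x :* y) :^ 5 := x :^ 5 :* y :^ 5) refl

  frobenius-constant : ∀ c → ⟦ c ⟧ ^ 5 ≈ ⟦ c ⟧
  frobenius-constant 0F = solve 0 (con 0F :^ 5 := con 0F) refl
  frobenius-constant 1F = solve 0 (con 1F :^ 5 := con 1F) refl
  frobenius-constant 2F = solve 0 (con 2F :^ 5 := con 2F) refl
  frobenius-constant 3F = solve 0 (con 3F :^ 5 := con 3F) refl
  frobenius-constant 4F = solve 0 (con 4F :^ 5 := con 4F) refl

  -- Nested fifth powers, so that Frobenius applies three times and no 125th power is expanded. On
  -- power series this is the substitution of q¹²⁵ for q.
  pow125 : Carrier → Carrier
  pow125 x = ((x ^ 5) ^ 5) ^ 5

  pow125-cong : ∀ {x y} → x ≈ y → pow125 x ≈ pow125 y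
  pow125-cong x≈y = ^-congˡ 5 (^-congˡ 5 (^-congˡ 5 x≈y))

  pow125-* : ∀ x y → pow125 (x * y) ≈ pow125 x * pow125 y
  pow125-* x y = trans (^-congˡ 5 (trans (^-congˡ 5 (frobenius-* x y)) (frobenius-* _ _))) (frobenius-* _ _)

  pow125-+ : ∀ x y → pow125 (x + y) ≈ pow125 x + pow125 y
  pow125-+ x y = trans (^-congˡ 5 (trans (^-congˡ 5 (frobenius-+ x y)) (frobenius-+ _ _))) (frobenius-+ _ _)

  -- From 125 = 1 + 4 (25 + 5 + 1). The cofactor x¹²⁴ is grouped as fifth powers times x⁴, the shape
  -- in which U(x⁵ y) = x U(y) can be used twice.
  pow125-split : ∀ x → pow125 x ≈ x * (((x ^ 4) ^ 5) ^ 5 * (x ^ 4) ^ 5 * x ^ 4)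
  pow125-split x = begin
    x * x ^ 4 * (x ^ 5) ^ 4 * ((x ^ 5) ^ 5) ^ 4
      ≈⟨ *-cong (*-congˡ (^-^-comm x 5 4)) (trans (^-^-comm (x ^ 5) 5 4) (^-congˡ 5 (^-^-comm x 5 4))) ⟩
    x * x ^ 4 * (x ^ 4) ^ 5 * ((x ^ 4) ^ 5) ^ 5
      ≈⟨ solve 4 (λ x a b c → x :* a :* b :* c := x :* (c :* b :* a)) refl x (x ^ 4) ((x ^ 4) ^ 5) (((x ^ 4) ^ 5) ^ 5) ⟩
    x * (((x ^ 4) ^ 5) ^ 5 * (x ^ 4) ^ 5 * x ^ 4) ∎
    where
    ^-^-comm : ∀ x m n → (x ^ m) ^ n ≈ (x ^ n) ^ m
    ^-^-comm x m n = trans (^-assocʳ x m n) (trans (^-congʳ x (ℕ.*-comm m n)) (sym (^-assocʳ x n m)))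

  -- Gauss's identity for finite products

  module Products (q : Carrier) where

    -- As 4 = -1 in F₅, `factor 1F j` is 1 + qʲ and `factor 4F j` is 1 - qʲ.
    factor : F₅ → ℕ → Carrier
    factor c j = ⟦ 1F ⟧ + ⟦ c ⟧ * q ^ j

    -- The product of factor c j over L < j ≤ L + m.
    product : F₅ → ℕ → ℕ → Carrier
    product c L zero    = ⟦ 1F ⟧
    product c L (suc m) = factor c (suc L) * product c (suc L) m

    product-snoc : ∀ c L m → product c L (suc m) ≈ product c L m * factor c (suc (L ℕ.+ m))
    product-snoc c L zero rewrite ℕ.+-identityʳ L = *-comm _ _
    product-snoc c L (suc m) = begin
      factor c (suc L) * product c (suc L) (suc m)
        ≈⟨ *-congˡ (product-snoc c (suc L) m) ⟩
      factor c (suc L) * (product c (suc L) m * factor c (suc (suc L ℕ.+ m)))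
        ≈⟨ *-assoc _ _ _ ⟨
      product c L (suc m) * factor c (suc (suc L ℕ.+ m))
        ≡⟨ ≡.cong (λ j → product c L (suc m) * factor c (suc j)) (ℕ.+-suc L m) ⟨
      product c L (suc m) * factor c (suc (L ℕ.+ suc m)) ∎

    product-++ : ∀ c L m n → product c L (m ℕ.+ n) ≈ product c L m * product c (L ℕ.+ m) n
    product-++ c L zero n rewrite ℕ.+-identityʳ L =
      solve 1 (λ p → p := con 1F :* p) refl _
    product-++ c L (suc m) n rewrite ℕ.+-suc L m =
      trans (*-congˡ (product-++ c (suc L) m n)) (sym (*-assoc _ _ _))

    -- Σ yⁱ Π (1 - qʲ) Π (1 + qᵏ) over L < j < i < k ≤ L + m.
    gaussTail : Carrier → ℕ → ℕ → Carrier
    gaussTail y L zero    = ⟦ 0F ⟧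
    gaussTail y L (suc m) = y ^ suc L * product 1F (suc L) m + factor 4F (suc L) * gaussTail y (suc L) m

    -- The i-th summands combine through (1 + y) qⁱ + (1 - y) = (1 + qⁱ) - y (1 - qⁱ).
    gaussTail-telescope : ∀ y L m →
      (⟦ 1F ⟧ + y) * gaussTail (q * y) L m + (⟦ 1F ⟧ - y) * gaussTail y L m ≈
      y ^ suc L * product 1F L m - y ^ suc (L ℕ.+ m) * product 4F L m
    gaussTail-telescope y L zero rewrite ℕ.+-identityʳ L =
      solve 2 (λ y z → (con 1F :+ y) :* con 0F :+ (con 1F :- y) :* con 0F := z :* con 1F :- z :* con 1F)
        refl y (y ^ suc L)
    gaussTail-telescope y L (suc m) = begin
      (⟦ 1F ⟧ + y) * ((q * y) ^ suc L * p + (⟦ 1F ⟧ + ⟦ 4F ⟧ * Q) * t₁)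
        + (⟦ 1F ⟧ - y) * (Y * p + (⟦ 1F ⟧ + ⟦ 4F ⟧ * Q) * t₂)
        ≈⟨ +-congʳ (*-congˡ (+-congʳ (*-congʳ (^-distrib-* q y (suc L))))) ⟩
      (⟦ 1F ⟧ + y) * ((Q * Y) * p + (⟦ 1F ⟧ + ⟦ 4F ⟧ * Q) * t₁)
        + (⟦ 1F ⟧ - y) * (Y * p + (⟦ 1F ⟧ + ⟦ 4F ⟧ * Q) * t₂)
        ≈⟨ solve 6 (λ y Q Y p t₁ t₂ →
             (con 1F :+ y) :* ((Q :* Y) :* p :+ (con 1F :+ con 4F :* Q) :* t₁)
               :+ (con 1F :- y) :* (Y :* p :+ (con 1F :+ con 4F :* Q) :* t₂)
             := Y :* p :* ((con 1F :+ y) :* Q :+ con 1F :- y)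
               :+ (con 1F :+ con 4F :* Q) :* ((con 1F :+ y) :* t₁ :+ (con 1F :- y) :* t₂))
             refl y Q Y p t₁ t₂ ⟩
      Y * p * ((⟦ 1F ⟧ + y) * Q + ⟦ 1F ⟧ - y)
        + (⟦ 1F ⟧ + ⟦ 4F ⟧ * Q) * ((⟦ 1F ⟧ + y) * t₁ + (⟦ 1F ⟧ - y) * t₂)
        ≈⟨ +-congˡ (*-congˡ (gaussTail-telescope y (suc L) m)) ⟩
      Y * p * ((⟦ 1F ⟧ + y) * Q + ⟦ 1F ⟧ - y)
        + (⟦ 1F ⟧ + ⟦ 4F ⟧ * Q) * (y * Y * p - E * n)
        ≈⟨ solve 6 (λ y Q Y p E n →
             Y :* p :* ((con 1F :+ y) :* Q :+ con 1F :- y)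
               :+ (con 1F :+ con 4F :* Q) :* (y :* Y :* p :- E :* n)
             := Y :* ((con 1F :+ con 1F :* Q) :* p) :- E :* ((con 1F :+ con 4F :* Q) :* n))
             refl y Q Y p E n ⟩
      Y * ((⟦ 1F ⟧ + ⟦ 1F ⟧ * Q) * p) - E * ((⟦ 1F ⟧ + ⟦ 4F ⟧ * Q) * n)
        ≡⟨ ≡.cong (λ k → Y * product 1F L (suc m) - y ^ suc k * product 4F L (suc m)) (ℕ.+-suc L m) ⟨
      Y * product 1F L (suc m) - y ^ suc (L ℕ.+ suc m) * product 4F L (suc m) ∎
      where
      Q = q ^ suc L
      Y = y ^ suc L
      E = y ^ suc (suc L ℕ.+ m)
      p = product 1F (suc L) m
      n = product 4F (suc L) m
      t₁ = gaussTail (q * y) (suc L) m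
      t₂ = gaussTail y (suc L) m

    -- Replacing the factors 1 + qⁱ by 1 - qⁱ one at a time costs 2 qⁱ times the remaining mixed
    -- product at each i. The variable y leaves room for the form `q ^ 1`.
    product-gaussTail : ∀ {y} → y ≈ q → ∀ L m →
      product 1F L m ≈ product 4F L m + ⟦ 2F ⟧ * gaussTail y L m
    product-gaussTail y≈q L zero = solve 0 (con 1F := con 1F :+ con 2F :* con 0F) refl
    product-gaussTail {y} y≈q L (suc m) = begin
      (⟦ 1F ⟧ + ⟦ 1F ⟧ * Q) * p
        ≈⟨ solve 2 (λ Q p → (con 1F :+ con 1F :* Q) :* p
             := (con 1F :+ con 4F :* Q) :* p :+ con 2F :* (Q :* p)) refl Q p ⟩
      (⟦ 1F ⟧ + ⟦ 4F ⟧ * Q) * p + ⟦ 2F ⟧ * (Q * p)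
        ≈⟨ +-cong (*-congˡ (product-gaussTail y≈q (suc L) m)) (*-congˡ (*-congʳ (^-congˡ (suc L) (sym y≈q)))) ⟩
      (⟦ 1F ⟧ + ⟦ 4F ⟧ * Q) * (n + ⟦ 2F ⟧ * t) + ⟦ 2F ⟧ * (Y * p)
        ≈⟨ solve 5 (λ Q Y n t p →
             (con 1F :+ con 4F :* Q) :* (n :+ con 2F :* t) :+ con 2F :* (Y :* p)
             := (con 1F :+ con 4F :* Q) :* n :+ con 2F :* (Y :* p :+ (con 1F :+ con 4F :* Q) :* t))
             refl Q Y n t p ⟩
      (⟦ 1F ⟧ + ⟦ 4F ⟧ * Q) * n + ⟦ 2F ⟧ * (Y * p + (⟦ 1F ⟧ + ⟦ 4F ⟧ * Q) * t) ∎
      where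
      Q = q ^ suc L
      Y = y ^ suc L
      p = product 1F (suc L) m
      n = product 4F (suc L) m
      t = gaussTail y (suc L) m

    sign : ℕ → Carrier
    sign k = ⟦ 4F ⟧ ^ k

    -- The terms of φ with -k ≤ x ≤ k, where x and -x are paired and (-q)^(x²) is written as (-1)ˣ
    -- q^(x²), since x² and x have the same parity.
    gaussSum : ℕ → Carrier
    gaussSum zero    = ⟦ 1F ⟧
    gaussSum (suc k) = gaussSum k + ⟦ 2F ⟧ * (sign (suc k) * q ^ (suc k ℕ.* suc k))

    -- Splitting off the first summand of the tail at k multiplies the rest by 1 - qᵏ⁺¹. For y =
    -- qᵏ⁺¹ this is the coefficient 1 - y required by `gaussTail-telescope`.
    gaussTail-step : ∀ k m → let y = q ^ suc k in
      (⟦ 1F ⟧ + y) * gaussTail (q * y) (suc k) m + gaussTail y k (suc m) ≈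
      y ^ suc k * ((⟦ 1F ⟧ + y) * product 1F (suc k) m)
        - y ^ suc (suc k ℕ.+ m) * product 4F (suc k) m
    gaussTail-step k m = begin
      (⟦ 1F ⟧ + y) * t₁ + (Y * p + (⟦ 1F ⟧ + ⟦ 4F ⟧ * y) * t₂)
        ≈⟨ solve 5 (λ y t₁ Y p t₂ →
             (con 1F :+ y) :* t₁ :+ (Y :* p :+ (con 1F :+ con 4F :* y) :* t₂)
             := Y :* p :+ ((con 1F :+ y) :* t₁ :+ (con 1F :- y) :* t₂)) refl y t₁ Y p t₂ ⟩
      Y * p + ((⟦ 1F ⟧ + y) * t₁ + (⟦ 1F ⟧ - y) * t₂)
        ≈⟨ +-congˡ (gaussTail-telescope y (suc k) m) ⟩
      Y * p + (y * Y * p - E)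
        ≈⟨ solve 4 (λ y Y p E → Y :* p :+ (y :* Y :* p :- E)
             := Y :* ((con 1F :+ y) :* p) :- E) refl y Y p E ⟩
      Y * ((⟦ 1F ⟧ + y) * p) - E ∎
      where
      y = q ^ suc k
      Y = y ^ suc k
      E = y ^ suc (suc k ℕ.+ m) * product 4F (suc k) m
      p = product 1F (suc k) m
      t₁ = gaussTail (q * y) (suc k) m
      t₂ = gaussTail y (suc k) m

    -- The tail is the remainder after the theta terms up to k. `gaussTail-step` extracts from it a
    -- term with q^((k+1)²), which cancels the next summand of `gaussSum`, and leaves the tail with
    -- y replaced by q y and the opposite sign. The boundary term yⁿ⁺¹ is a multiple of qⁿ⁺¹ and is
    -- absorbed in r. At k = n the tail is empty.
    gauss-partial : ∀ n k m → k ℕ.+ m ≡ n → ∃ λ r →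
      gaussSum k * product 1F 0 n ≈
      product 4F 0 n + ⟦ 2F ⟧ * (sign k * (product 1F 0 k * gaussTail (q ^ suc k) k m)) + q ^ suc n * r
    gauss-partial n zero .n ≡.refl = ⟦ 0F ⟧ , (begin
      ⟦ 1F ⟧ * product 1F 0 n
        ≈⟨ *-congˡ (product-gaussTail (*-identityʳ q) 0 n) ⟩
      ⟦ 1F ⟧ * (product 4F 0 n + ⟦ 2F ⟧ * gaussTail (q ^ 1) 0 n)
        ≈⟨ solve 3 (λ a b c → con 1F :* (a :+ con 2F :* b)
             := a :+ con 2F :* (c :^ 0 :* (con 1F :* b)) :+ c :* con 0F) refl _ _ _ ⟩
      product 4F 0 n + ⟦ 2F ⟧ * (1# * (⟦ 1F ⟧ * gaussTail (q ^ 1) 0 n)) + q ^ suc n * ⟦ 0F ⟧ ∎)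
    gauss-partial n (suc k) m eq with gauss-partial n k (suc m) (≡.trans (ℕ.+-suc k m) eq)
    ... | r , ih = r - ⟦ 2F ⟧ * (s * (pₖ * (E * M))) , (begin
      (gaussSum k + ⟦ 2F ⟧ * (⟦ 4F ⟧ * s * q ^ (suc k ℕ.* suc k))) * P
        ≈⟨ *-congʳ (+-congˡ (*-congˡ (*-congˡ (^-assocʳ q (suc k) (suc k))))) ⟨
      (gaussSum k + ⟦ 2F ⟧ * (⟦ 4F ⟧ * s * Y)) * P
        ≈⟨ distribʳ _ _ _ ⟩
      gaussSum k * P + ⟦ 2F ⟧ * (⟦ 4F ⟧ * s * Y) * P
        ≈⟨ +-cong ih (*-congˡ P≈) ⟩
      N + ⟦ 2F ⟧ * (s * (pₖ * t₂)) + B * r + ⟦ 2F ⟧ * (⟦ 4F ⟧ * s * Y) * (pₖ * ((⟦ 1F ⟧ + y) * p))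
        -- The multiple (1 + y) t₁ is added and subtracted, to create the left-hand side of
        -- `gaussTail-step`.
        ≈⟨ solve 9 (λ N s pₖ t₂ t₁ Br Y y p →
             N :+ con 2F :* (s :* (pₖ :* t₂)) :+ Br
               :+ con 2F :* (con 4F :* s :* Y) :* (pₖ :* ((con 1F :+ y) :* p))
             := N :+ con 2F :* (s :* (pₖ :* ((con 1F :+ y) :* t₁ :+ t₂))) :+ Br
               :+ con 2F :* (con 4F :* s :* Y) :* (pₖ :* ((con 1F :+ y) :* p))
               :- con 2F :* (s :* (pₖ :* ((con 1F :+ y) :* t₁))))
             refl N s pₖ t₂ t₁ (B * r) Y y p ⟩
      N + ⟦ 2F ⟧ * (s * (pₖ * ((⟦ 1F ⟧ + y) * t₁ + t₂))) + B * r
        + ⟦ 2F ⟧ * (⟦ 4F ⟧ * s * Y) * (pₖ * ((⟦ 1F ⟧ + y) * p))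
        - ⟦ 2F ⟧ * (s * (pₖ * ((⟦ 1F ⟧ + y) * t₁)))
        ≈⟨ +-congʳ (+-congʳ (+-congʳ (+-congˡ (*-congˡ (*-congˡ (*-congˡ step)))))) ⟩
      N + ⟦ 2F ⟧ * (s * (pₖ * (Y * ((⟦ 1F ⟧ + y) * p) - B * E * M))) + B * r
        + ⟦ 2F ⟧ * (⟦ 4F ⟧ * s * Y) * (pₖ * ((⟦ 1F ⟧ + y) * p))
        - ⟦ 2F ⟧ * (s * (pₖ * ((⟦ 1F ⟧ + y) * t₁)))
        -- Since 4 = -1, both terms with Y cancel and the subtracted t₁ acquires the next sign 4 s.
        ≈⟨ solve 11 (λ N s pₖ t₁ B E M r Y y p →
             N :+ con 2F :* (s :* (pₖ :* (Y :* ((con 1F :+ y) :* p) :- B :* E :* M))) :+ B :* r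
               :+ con 2F :* (con 4F :* s :* Y) :* (pₖ :* ((con 1F :+ y) :* p))
               :- con 2F :* (s :* (pₖ :* ((con 1F :+ y) :* t₁)))
             := N :+ con 2F :* (con 4F :* s :* (pₖ :* (con 1F :+ con 1F :* y) :* t₁))
               :+ B :* (r :- con 2F :* (s :* (pₖ :* (E :* M)))))
             refl N s pₖ t₁ B E M r Y y p ⟩
      N + ⟦ 2F ⟧ * (⟦ 4F ⟧ * s * (pₖ * (⟦ 1F ⟧ + ⟦ 1F ⟧ * y) * t₁))
        + B * (r - ⟦ 2F ⟧ * (s * (pₖ * (E * M))))
        ≈⟨ +-congʳ (+-congˡ (*-congˡ (*-congˡ (*-congʳ (product-snoc 1F 0 k))))) ⟨
      N + ⟦ 2F ⟧ * (⟦ 4F ⟧ * s * (product 1F 0 (suc k) * t₁))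
        + B * (r - ⟦ 2F ⟧ * (s * (pₖ * (E * M)))) ∎)
      where
      s = sign k
      y = q ^ suc k
      Y = y ^ suc k
      B = q ^ suc n
      E = (q ^ k) ^ suc n
      P = product 1F 0 n
      N = product 4F 0 n
      M = product 4F (suc k) m
      p = product 1F (suc k) m
      pₖ = product 1F 0 k
      t₁ = gaussTail (q * y) (suc k) m
      t₂ = gaussTail y k (suc m)
      P≈ : P ≈ pₖ * ((⟦ 1F ⟧ + y) * p)
      P≈ = begin
        product 1F 0 n                             ≡⟨ ≡.cong (product 1F 0) (≡.trans (ℕ.+-suc k m) eq) ⟨
        product 1F 0 (k ℕ.+ suc m)                 ≈⟨ product-++ 1F 0 k (suc m) ⟩
        pₖ * ((⟦ 1F ⟧ + ⟦ 1F ⟧ * y) * p)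
          ≈⟨ solve 3 (λ a y p → a :* ((con 1F :+ con 1F :* y) :* p) := a :* ((con 1F :+ y) :* p)) refl pₖ y p ⟩
        pₖ * ((⟦ 1F ⟧ + y) * p) ∎
      step : (⟦ 1F ⟧ + y) * t₁ + t₂ ≈ Y * ((⟦ 1F ⟧ + y) * p) - B * E * M
      step = begin
        (⟦ 1F ⟧ + y) * t₁ + t₂
          ≈⟨ gaussTail-step k m ⟩
        Y * ((⟦ 1F ⟧ + y) * p) - y ^ suc (suc k ℕ.+ m) * M
          ≡⟨ ≡.cong (λ j → Y * ((⟦ 1F ⟧ + y) * p) - y ^ suc j * M) eq ⟩
        Y * ((⟦ 1F ⟧ + y) * p) - y ^ suc n * M
          ≈⟨ +-congˡ (-‿cong (*-congʳ (^-distrib-* q (q ^ k) (suc n)))) ⟩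
        Y * ((⟦ 1F ⟧ + y) * p) - B * E * M ∎

    gauss : ∀ n → ∃ λ r → gaussSum n * product 1F 0 n ≈ product 4F 0 n + q ^ suc n * r
    gauss n with gauss-partial n n 0 (ℕ.+-identityʳ n)
    ... | r , eq = r , trans eq (+-congʳ
      (solve 3 (λ N s p → N :+ con 2F :* (s :* (p :* con 0F)) := N) refl _ _ _))

    -- Separating the factors whose index is a multiple of 125

    frobenius-linear : ∀ c x → (⟦ 1F ⟧ + ⟦ c ⟧ * x) ^ 5 ≈ ⟦ 1F ⟧ + ⟦ c ⟧ * x ^ 5
    frobenius-linear c x = trans (frobenius-+ _ _)
      (+-cong (frobenius-constant 1F) (trans (frobenius-* _ _) (*-congʳ (frobenius-constant c))))

    factor-^5 : ∀ c j → factor c j ^ 5 ≈ factor c (j ℕ.* 5)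
    factor-^5 c j = trans (frobenius-linear c (q ^ j)) (+-congˡ (*-congˡ (^-assocʳ q j 5)))

    pow125-factor : ∀ c j → pow125 (factor c j) ≈ factor c (j ℕ.* 125)
    pow125-factor c j = begin
      pow125 (factor c j)                ≈⟨ ^-congˡ 5 (^-congˡ 5 (factor-^5 c j)) ⟩
      (factor c (j ℕ.* 5) ^ 5) ^ 5     ≈⟨ ^-congˡ 5 (factor-^5 c (j ℕ.* 5)) ⟩
      factor c (j ℕ.* 5 ℕ.* 5) ^ 5     ≈⟨ factor-^5 c (j ℕ.* 5 ℕ.* 5) ⟩
      factor c (j ℕ.* 5 ℕ.* 5 ℕ.* 5)
        ≡⟨ ≡.cong (factor c) (≡.trans (ℕ.*-assoc (j ℕ.* 5) 5 5) (ℕ.*-assoc j 5 25)) ⟩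
      factor c (j ℕ.* 125) ∎

    nonMultiplePart multiplePart : F₅ → ℕ → Carrier
    nonMultiplePart c zero = ⟦ 1F ⟧
    nonMultiplePart c (suc k) with 125 ∣? suc k
    ... | yes _ = nonMultiplePart c k
    ... | no _  = nonMultiplePart c k * factor c (suc k)
    multiplePart c zero = ⟦ 1F ⟧
    multiplePart c (suc k) with 125 ∣? suc k
    ... | yes _ = multiplePart c k * factor c (suc k)
    ... | no _  = multiplePart c k

    product-parts : ∀ c k → product c 0 k ≈ nonMultiplePart c k * multiplePart c k
    product-parts c zero = solve 0 (con 1F := con 1F :* con 1F) refl
    product-parts c (suc k) with 125 ∣? suc k
    ... | yes _ = begin
      product c 0 (suc k)                                         ≈⟨ product-snoc c 0 k ⟩
      product c 0 k * factor c (suc k)                            ≈⟨ *-congʳ (product-parts c k) ⟩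
      nonMultiplePart c k * multiplePart c k * factor c (suc k)       ≈⟨ *-assoc _ _ _ ⟩
      nonMultiplePart c k * (multiplePart c k * factor c (suc k))     ∎
    ... | no _ = begin
      product c 0 (suc k)                                         ≈⟨ product-snoc c 0 k ⟩
      product c 0 k * factor c (suc k)                            ≈⟨ *-congʳ (product-parts c k) ⟩
      nonMultiplePart c k * multiplePart c k * factor c (suc k)
        ≈⟨ solve 3 (λ a b c → a :* b :* c := a :* c :* b) refl _ _ _ ⟩
      nonMultiplePart c k * factor c (suc k) * multiplePart c k       ∎

    multiplePart-∣ : ∀ c k → 125 ∣ suc k → multiplePart c (suc k) ≈ multiplePart c k * factor c (suc k)
    multiplePart-∣ c k d with 125 ∣? suc k
    ... | yes _ = refl
    ... | no ∤d = contradiction d ∤d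

    multiplePart-∤ : ∀ c k → ¬ 125 ∣ suc k → multiplePart c (suc k) ≈ multiplePart c k
    multiplePart-∤ c k ∤d with 125 ∣? suc k
    ... | yes d = contradiction d ∤d
    ... | no _  = refl

    -- The factor at 125 j is the 125th power of the factor at j. The induction descends through k =
    -- r + 125 M: only r = 0 meets a multiple of 125, after which the remainder restarts at 124 with
    -- M lowered by one.
    multiplePart-shift : ∀ c M r k → k ≡ r ℕ.+ M ℕ.* 125 → r ℕ.< 125 → multiplePart c k ≈ pow125 (product c 0 M)
    multiplePart-shift c zero zero .0 ≡.refl _ = solve 0 (con 1F := ((con 1F :^ 5) :^ 5) :^ 5) refl
    multiplePart-shift c (suc M) zero (suc k) eq _ = begin
      multiplePart c (suc k)
        ≈⟨ multiplePart-∣ c k (divides (suc M) eq) ⟩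
      multiplePart c k * factor c (suc k)
        ≈⟨ *-cong (multiplePart-shift c M 124 k (ℕ.suc-injective eq) ℕ.≤-refl)
                  (trans (reflexive (≡.cong (factor c) eq)) (sym (pow125-factor c (suc M)))) ⟩
      pow125 (product c 0 M) * pow125 (factor c (suc M))  ≈⟨ pow125-* _ _ ⟨
      pow125 (product c 0 M * factor c (suc M))         ≈⟨ pow125-cong (product-snoc c 0 M) ⟨
      pow125 (product c 0 (suc M))                      ∎
    multiplePart-shift c M (suc r) (suc k) eq r<125 =
      trans (multiplePart-∤ c k ∤k) (multiplePart-shift c M r k (ℕ.suc-injective eq) (ℕ.<-trans (ℕ.n<1+n r) r<125))
      where
      ∤k : ¬ 125 ∣ suc k
      ∤k d = >⇒∤ r<125 (∣m+n∣m⇒∣n (≡.subst (125 ∣_) (≡.trans eq (ℕ.+-comm (suc r) _)) d) (n∣m*n M))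

    product-125 : ∀ c M n → n ≡ M ℕ.* 125 → product c 0 n ≈ nonMultiplePart c n * pow125 (product c 0 M)
    product-125 c M n eq =
      trans (product-parts c n) (*-congˡ (multiplePart-shift c M 0 n eq (ℕ.s≤s ℕ.z≤n)))

    -- G k plays the role of the generating function with parts at most k.
    module _ (G : ℕ → Carrier)
             (G-zero : G 0 ≈ ⟦ 1F ⟧)
             (G-∣ : ∀ k → 125 ∣ suc k → G (suc k) ≈ G k)
             (G-∤ : ∀ k → ¬ 125 ∣ suc k → G (suc k) * factor 4F (suc k) ≈ G k * factor 1F (suc k))
             where

      G-product : ∀ k → G k * nonMultiplePart 4F k ≈ nonMultiplePart 1F k
      G-product zero = trans (*-congʳ G-zero) (solve 0 (con 1F :* con 1F := con 1F) refl)
      G-product (suc k) with 125 ∣? suc k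
      ... | yes d = trans (*-congʳ (G-∣ k d)) (G-product k)
      ... | no ∤d = begin
        G (suc k) * (C * factor 4F (suc k))  ≈⟨ solve 3 (λ a b c → a :* (b :* c) := a :* c :* b) refl _ _ _ ⟩
        G (suc k) * factor 4F (suc k) * C    ≈⟨ *-congʳ (G-∤ k ∤d) ⟩
        G k * factor 1F (suc k) * C          ≈⟨ solve 3 (λ a b c → a :* b :* c := a :* c :* b) refl _ _ _ ⟩
        G k * C * factor 1F (suc k)          ≈⟨ *-congʳ (G-product k) ⟩
        nonMultiplePart 1F k * factor 1F (suc k) ∎
        where C = nonMultiplePart 4F k

      -- The identity G φ = φ(q¹²⁵) with denominators cleared. Gauss's identity is used at n, and at
      -- M after raising it to the 125th power; the non-multiple parts are exchanged by `G-product`.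
      -- Both errors are multiples of q^(M+1), the first because n = 125 M.
      G-gaussSum : ∀ M n → n ≡ M ℕ.* 125 → let W = product 1F 0 n * pow125 (product 1F 0 M) in
        ∃ λ r → G n * gaussSum n * W ≈ pow125 (gaussSum M) * W + q ^ suc M * r
      G-gaussSum M n n≡ with gauss n | gauss M
      ... | r , eqₙ | r′ , eqₘ = _ , (begin
        g * S * (P * FP)
          ≈⟨ solve 4 (λ g S P FP → g :* S :* (P :* FP) := g :* FP :* (S :* P)) refl g S P FP ⟩
        g * FP * (S * P)
          ≈⟨ *-congˡ eqₙ′ ⟩
        g * FP * (C₄ * FN + z * x * r)
          ≈⟨ solve 7 (λ g FP C₄ FN z x r → g :* FP :* (C₄ :* FN :+ z :* x :* r)
               := g :* C₄ :* FP :* FN :+ z :* (g :* FP :* x :* r)) refl g FP C₄ FN z x r ⟩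
        g * C₄ * FP * FN + z * (g * FP * x * r)
          ≈⟨ +-congʳ (*-congʳ (*-congʳ (G-product n))) ⟩
        C₁ * FP * FN + z * (g * FP * x * r)
          ≈⟨ +-congʳ (*-congʳ (product-125 1F M n n≡)) ⟨
        P * FN + z * (g * FP * x * r)
          -- The error of the identity at M is inserted and subtracted again, so that `eqₘ′`
          -- applies.
          ≈⟨ solve 5 (λ P FN z a b → P :* FN :+ z :* a
               := P :* (FN :+ z :* b) :+ z :* (a :- P :* b)) refl P FN z (g * FP * x * r) (w * pow125 r′) ⟩
        P * (FN + z * (w * pow125 r′)) + z * (g * FP * x * r - P * (w * pow125 r′))
          ≈⟨ +-congʳ (*-congˡ eqₘ′) ⟨
        P * (FS * FP) + z * (g * FP * x * r - P * (w * pow125 r′))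
          ≈⟨ +-congʳ (solve 3 (λ P FS FP → P :* (FS :* FP) := FS :* (P :* FP)) refl P FS FP) ⟩
        FS * (P * FP) + z * (g * FP * x * r - P * (w * pow125 r′)) ∎)
        where
        g = G n
        z = q ^ suc M
        -- From 125 M + 1 = (M + 1) + 124 M.
        x = q ^ (M ℕ.* 124)
        S = gaussSum n
        P = product 1F 0 n
        FP = pow125 (product 1F 0 M)
        FN = pow125 (product 4F 0 M)
        FS = pow125 (gaussSum M)
        C₁ = nonMultiplePart 1F n
        C₄ = nonMultiplePart 4F n
        z≈ : q ^ suc n ≈ z * x
        z≈ = trans (reflexive (≡.cong (λ j → q ^ suc j) (≡.trans n≡ (ℕ.*-suc M 124)))) (^-homo-* q (suc M) (M ℕ.* 124))
        eqₙ′ : S * P ≈ C₄ * FN + z * x * r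
        eqₙ′ = trans eqₙ (+-cong (product-125 4F M n n≡) (*-congʳ z≈))
        -- This is z¹²⁴, grouped so that z w equals `pow125 z` by associativity alone.
        w = z ^ 4 * ((z ^ 5) ^ 4 * ((z ^ 5) ^ 5) ^ 4)
        pow125-z : pow125 z ≈ z * w
        pow125-z = trans (*-assoc _ _ _) (*-assoc _ _ _)
        eqₘ′ : FS * FP ≈ FN + z * (w * pow125 r′)
        eqₘ′ = begin
          FS * FP                               ≈⟨ pow125-* _ _ ⟨
          pow125 (gaussSum M * product 1F 0 M)  ≈⟨ pow125-cong eqₘ ⟩
          pow125 (product 4F 0 M + z * r′)      ≈⟨ pow125-+ _ _ ⟩
          FN + pow125 (z * r′)                  ≈⟨ +-congˡ (pow125-* _ _) ⟩
          FN + pow125 z * pow125 r′             ≈⟨ +-congˡ (*-congʳ pow125-z) ⟩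
          FN + z * w * pow125 r′                ≈⟨ +-congˡ (*-assoc _ _ _) ⟩
          FN + z * (w * pow125 r′)              ∎

  -- The action of U on powers of φ

  module Descent
    (q : Carrier)
    (U : Carrier → Carrier)
    (U-cong : ∀ {x y} → x ≈ y → U x ≈ U y)
    (U-+ : ∀ x y → U (x + y) ≈ U x + U y)
    (U-^5-* : ∀ x y → U (x ^ 5 * y) ≈ x * U y)
    (U-1 : U ⟦ 1F ⟧ ≈ ⟦ 1F ⟧)
    (U-q : ∀ (r : Fin 4) → U (q ^ suc (toℕ r)) ≈ ⟦ 0F ⟧)
    where

    -- The dissection by exponents modulo 5: for power series xᵣ⁵ is xᵣ(q⁵), so the summand with qʳ
    -- holds the exponents congruent to r, and U reads off x₀.
    assemble : (x₀ x₁ x₂ x₃ x₄ : Carrier) → Carrier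
    assemble x₀ x₁ x₂ x₃ x₄ =
      x₀ ^ 5 + x₁ ^ 5 * q ^ 1 + x₂ ^ 5 * q ^ 2 + x₃ ^ 5 * q ^ 3 + x₄ ^ 5 * q ^ 4

    private
      U-^5 : ∀ x → U (x ^ 5) ≈ x
      U-^5 x = begin
        U (x ^ 5)           ≈⟨ U-cong (solve 1 (λ x → x := x :* con 1F) refl (x ^ 5)) ⟩
        U (x ^ 5 * ⟦ 1F ⟧)  ≈⟨ U-^5-* x ⟦ 1F ⟧ ⟩
        x * U ⟦ 1F ⟧        ≈⟨ *-congˡ U-1 ⟩
        x * ⟦ 1F ⟧          ≈⟨ solve 1 (λ x → x :* con 1F := x) refl x ⟩
        x                   ∎

      U-^5-q : ∀ x (r : Fin 4) → U (x ^ 5 * q ^ suc (toℕ r)) ≈ ⟦ 0F ⟧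
      U-^5-q x r = trans (U-^5-* x _) (trans (*-congˡ (U-q r)) (solve 1 (λ x → x :* con 0F := con 0F) refl x))

      U-+₀ : ∀ {x y z} → U x ≈ z → U y ≈ ⟦ 0F ⟧ → U (x + y) ≈ z
      U-+₀ {z = z} Ux Uy = trans (U-+ _ _) (trans (+-cong Ux Uy) (solve 1 (λ z → z :+ con 0F := z) refl z))

    U-assemble : ∀ x₀ x₁ x₂ x₃ x₄ → U (assemble x₀ x₁ x₂ x₃ x₄) ≈ x₀
    U-assemble x₀ x₁ x₂ x₃ x₄ =
      U-+₀ (U-+₀ (U-+₀ (U-+₀ (U-^5 x₀) (U-^5-q x₁ 0F)) (U-^5-q x₂ 1F)) (U-^5-q x₃ 2F)) (U-^5-q x₄ 3F)

    -- Residues add modulo 5. A carry produces q⁵, which enters the fifth power as a factor q.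
    assemble-* : ∀ x₀ x₁ x₂ x₃ x₄ y₀ y₁ y₂ y₃ y₄ →
      assemble x₀ x₁ x₂ x₃ x₄ * assemble y₀ y₁ y₂ y₃ y₄ ≈
      assemble
        (x₀ * y₀ + q * (x₁ * y₄ + x₂ * y₃ + x₃ * y₂ + x₄ * y₁))
        (x₀ * y₁ + x₁ * y₀ + q * (x₂ * y₄ + x₃ * y₃ + x₄ * y₂))
        (x₀ * y₂ + x₁ * y₁ + x₂ * y₀ + q * (x₃ * y₄ + x₄ * y₃))
        (x₀ * y₃ + x₁ * y₂ + x₂ * y₁ + x₃ * y₀ + q * (x₄ * y₄))
        (x₀ * y₄ + x₁ * y₃ + x₂ * y₂ + x₃ * y₁ + x₄ * y₀)
    assemble-* = solve 11 (λ q x₀ x₁ x₂ x₃ x₄ y₀ y₁ y₂ y₃ y₄ →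
      let asm = λ x₀ x₁ x₂ x₃ x₄ →
            x₀ :^ 5 :+ x₁ :^ 5 :* q :^ 1 :+ x₂ :^ 5 :* q :^ 2 :+ x₃ :^ 5 :* q :^ 3 :+ x₄ :^ 5 :* q :^ 4 in
      asm x₀ x₁ x₂ x₃ x₄ :* asm y₀ y₁ y₂ y₃ y₄ :=
      asm
        (x₀ :* y₀ :+ q :* (x₁ :* y₄ :+ x₂ :* y₃ :+ x₃ :* y₂ :+ x₄ :* y₁))
        (x₀ :* y₁ :+ x₁ :* y₀ :+ q :* (x₂ :* y₄ :+ x₃ :* y₃ :+ x₄ :* y₂))
        (x₀ :* y₂ :+ x₁ :* y₁ :+ x₂ :* y₀ :+ q :* (x₃ :* y₄ :+ x₄ :* y₃))
        (x₀ :* y₃ :+ x₁ :* y₂ :+ x₂ :* y₁ :+ x₃ :* y₀ :+ q :* (x₄ :* y₄))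
        (x₀ :* y₄ :+ x₁ :* y₃ :+ x₂ :* y₂ :+ x₃ :* y₁ :+ x₄ :* y₀)) refl q

    module _
      (φ B C : Carrier)
      (φ-split : φ ≈ (φ ^ 5) ^ 5 + B ^ 5 * q + C ^ 5 * q ^ 4)
      (U-φ² : U (φ * φ) + (φ * φ) ^ 5 ≈ ⟦ 2F ⟧ * (φ * φ))
      where

      -- When φ is a power series, α is φ(q⁵) and p and e are U(b c) and U(b⁵ + c⁵) for the
      -- two nonzero residue parts b = q B⁵ and c = q⁴ C⁵ of φ.
      private
        α p e : Carrier
        α = φ ^ 5
        p = q * (B * C)
        e = q * B ^ 5 + q ^ 4 * C ^ 5
        -- The components of φ² and of φ⁴, obtained by squaring the dissection α, B, 0, 0, C of φ
        -- once and twice.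
        x₀ x₁ x₂ x₃ x₄ y₀ y₁ y₂ y₃ y₄ : Carrier
        x₀ = α * α + ⟦ 2F ⟧ * (q * (B * C))
        x₁ = ⟦ 2F ⟧ * (α * B)
        x₂ = B * B
        x₃ = q * (C * C)
        x₄ = ⟦ 2F ⟧ * (α * C)
        y₀ = x₀ * x₀ + q * (x₁ * x₄ + x₂ * x₃ + x₃ * x₂ + x₄ * x₁)
        y₁ = x₀ * x₁ + x₁ * x₀ + q * (x₂ * x₄ + x₃ * x₃ + x₄ * x₂)
        y₂ = x₀ * x₂ + x₁ * x₁ + x₂ * x₀ + q * (x₃ * x₄ + x₄ * x₃)
        y₃ = x₀ * x₃ + x₁ * x₂ + x₂ * x₁ + x₃ * x₀ + q * (x₄ * x₄)
        y₄ = x₀ * x₄ + x₁ * x₃ + x₂ * x₂ + x₃ * x₁ + x₄ * x₀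

        φ²≈ : φ * φ ≈ assemble x₀ x₁ x₂ x₃ x₄
        φ²≈ = begin
          φ * φ  ≈⟨ *-cong φ-split φ-split ⟩
          (α ^ 5 + B ^ 5 * q + C ^ 5 * q ^ 4) * (α ^ 5 + B ^ 5 * q + C ^ 5 * q ^ 4)
            ≈⟨ solve 4 (λ q α B C →
                 (α :^ 5 :+ B :^ 5 :* q :+ C :^ 5 :* q :^ 4) :* (α :^ 5 :+ B :^ 5 :* q :+ C :^ 5 :* q :^ 4)
                 := (α :* α :+ con 2F :* (q :* (B :* C))) :^ 5 :+ (con 2F :* (α :* B)) :^ 5 :* q :^ 1
                   :+ (B :* B) :^ 5 :* q :^ 2 :+ (q :* (C :* C)) :^ 5 :* q :^ 3
                   :+ (con 2F :* (α :* C)) :^ 5 :* q :^ 4)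
                 refl q α B C ⟩
          assemble x₀ x₁ x₂ x₃ x₄ ∎

        φ⁴≈ : φ ^ 4 ≈ assemble y₀ y₁ y₂ y₃ y₄
        φ⁴≈ = begin
          φ ^ 4              ≈⟨ solve 1 (λ φ → φ :^ 4 := φ :* φ :* (φ :* φ)) refl φ ⟩
          φ * φ * (φ * φ)    ≈⟨ *-cong φ²≈ φ²≈ ⟩
          _                  ≈⟨ assemble-* x₀ x₁ x₂ x₃ x₄ x₀ x₁ x₂ x₃ x₄ ⟩
          assemble y₀ y₁ y₂ y₃ y₄ ∎

        -- Here U(φ²) is x₀ = α² + 2 p and (φ²)⁵ is α², so `U-φ²` reads 2 α² + 2 p = 2 φ². The
        -- factor 3 is the inverse of 2 in F₅.
        p≈ : p ≈ φ * φ - α * α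
        p≈ = begin
          p
            ≈⟨ solve 2 (λ p a → p := con 3F :* (a :+ con 2F :* p :+ a) :- a) refl p (α * α) ⟩
          ⟦ 3F ⟧ * (x₀ + α * α) - α * α
            ≈⟨ +-congʳ (*-congˡ (+-cong (trans (U-cong φ²≈) (U-assemble x₀ x₁ x₂ x₃ x₄)) (frobenius-* φ φ))) ⟨
          ⟦ 3F ⟧ * (U (φ * φ) + (φ * φ) ^ 5) - α * α
            ≈⟨ +-congʳ (*-congˡ U-φ²) ⟩
          ⟦ 3F ⟧ * (⟦ 2F ⟧ * (φ * φ)) - α * α
            ≈⟨ solve 2 (λ b a → con 3F :* (con 2F :* b) :- a := b :- a) refl (φ * φ) (α * α) ⟩
          φ * φ - α * α ∎

        e≈ : e ≈ φ - α ^ 5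
        e≈ = begin
          e
            ≈⟨ solve 4 (λ q α B C → q :* B :^ 5 :+ q :^ 4 :* C :^ 5
                 := α :^ 5 :+ B :^ 5 :* q :+ C :^ 5 :* q :^ 4 :- α :^ 5) refl q α B C ⟩
          α ^ 5 + B ^ 5 * q + C ^ 5 * q ^ 4 - α ^ 5
            ≈⟨ +-congʳ φ-split ⟨
          φ - α ^ 5 ∎

      -- Modulo 5 the component y₀ is the perfect square (α² + p)², and α² + p = φ².
      U-φ⁴ : U (φ ^ 4) ≈ φ ^ 4
      U-φ⁴ = begin
        U (φ ^ 4)            ≈⟨ U-cong φ⁴≈ ⟩
        _                    ≈⟨ U-assemble y₀ y₁ y₂ y₃ y₄ ⟩
        y₀                   ≈⟨ solve 4 (λ q α B C →
                                  let p = q :* (B :* C)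
                                      x₀ = α :* α :+ con 2F :* p
                                      x₁ = con 2F :* (α :* B)
                                      x₂ = B :* B
                                      x₃ = q :* (C :* C)
                                      x₄ = con 2F :* (α :* C) in
                                  x₀ :* x₀ :+ q :* (x₁ :* x₄ :+ x₂ :* x₃ :+ x₃ :* x₂ :+ x₄ :* x₁)
                                  := α :^ 4 :+ con 2F :* α :^ 2 :* p :+ p :^ 2) refl q α B C ⟩
        α ^ 4 + ⟦ 2F ⟧ * α ^ 2 * p + p ^ 2
          ≈⟨ +-cong (+-congˡ (*-congˡ p≈)) (^-congˡ 2 p≈) ⟩
        α ^ 4 + ⟦ 2F ⟧ * α ^ 2 * (φ * φ - α * α) + (φ * φ - α * α) ^ 2
          ≈⟨ solve 2 (λ α φ → α :^ 4 :+ con 2F :* α :^ 2 :* (φ :* φ :- α :* α) :+ (φ :* φ :- α :* α) :^ 2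
               := φ :^ 4) refl α φ ⟩
        φ ^ 4 ∎

      -- The component of residue 0 is α⁸ + α⁶ p + α (α² + p) e. Substituting p = φ² - α² and e = φ
      -- - α⁵ leaves only α φ³, which is φ⁸ because α = φ⁵.
      U-φ⁸ : U (φ ^ 8) ≈ φ ^ 8
      U-φ⁸ = begin
        U (φ ^ 8)
          ≈⟨ U-cong (solve 1 (λ φ → φ :^ 8 := φ :^ 4 :* φ :^ 4) refl φ) ⟩
        U (φ ^ 4 * φ ^ 4)
          ≈⟨ U-cong (*-cong φ⁴≈ φ⁴≈) ⟩
        _
          ≈⟨ U-cong (assemble-* y₀ y₁ y₂ y₃ y₄ y₀ y₁ y₂ y₃ y₄) ⟩
        _
          ≈⟨ U-assemble _ _ _ _ _ ⟩
        y₀ * y₀ + q * (y₁ * y₄ + y₂ * y₃ + y₃ * y₂ + y₄ * y₁)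
          ≈⟨ solve 4 (λ q α B C →
               let p = q :* (B :* C)
                   x₀ = α :* α :+ con 2F :* p
                   x₁ = con 2F :* (α :* B)
                   x₂ = B :* B
                   x₃ = q :* (C :* C)
                   x₄ = con 2F :* (α :* C)
                   y₀ = x₀ :* x₀ :+ q :* (x₁ :* x₄ :+ x₂ :* x₃ :+ x₃ :* x₂ :+ x₄ :* x₁)
                   y₁ = x₀ :* x₁ :+ x₁ :* x₀ :+ q :* (x₂ :* x₄ :+ x₃ :* x₃ :+ x₄ :* x₂)
                   y₂ = x₀ :* x₂ :+ x₁ :* x₁ :+ x₂ :* x₀ :+ q :* (x₃ :* x₄ :+ x₄ :* x₃)
                   y₃ = x₀ :* x₃ :+ x₁ :* x₂ :+ x₂ :* x₁ :+ x₃ :* x₀ :+ q :* (x₄ :* x₄)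
                   y₄ = x₀ :* x₄ :+ x₁ :* x₃ :+ x₂ :* x₂ :+ x₃ :* x₁ :+ x₄ :* x₀ in
               y₀ :* y₀ :+ q :* (y₁ :* y₄ :+ y₂ :* y₃ :+ y₃ :* y₂ :+ y₄ :* y₁)
               := α :^ 8 :+ α :^ 6 :* p :+ (α :^ 3 :+ α :* p) :* (q :* B :^ 5 :+ q :^ 4 :* C :^ 5))
               refl q α B C ⟩
        α ^ 8 + α ^ 6 * p + (α ^ 3 + α * p) * e
          ≈⟨ +-cong (+-congˡ (*-congˡ p≈)) (*-cong (+-congˡ (*-congˡ p≈)) e≈) ⟩
        α ^ 8 + α ^ 6 * (φ * φ - α * α) + (α ^ 3 + α * (φ * φ - α * α)) * (φ - α ^ 5)
          ≈⟨ solve 2 (λ α φ →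
               α :^ 8 :+ α :^ 6 :* (φ :* φ :- α :* α) :+ (α :^ 3 :+ α :* (φ :* φ :- α :* α)) :* (φ :- α :^ 5)
               := α :* φ :^ 3) refl α φ ⟩
        φ ^ 5 * φ ^ 3
          ≈⟨ solve 1 (λ φ → φ :^ 5 :* φ :^ 3 := φ :^ 8) refl φ ⟩
        φ ^ 8 ∎

      U-φ¹² : U (φ ^ 12) ≈ ⟦ 2F ⟧ * φ ^ 4 - φ ^ 12
      U-φ¹² = begin
        U (φ ^ 12)
          ≈⟨ U-cong (solve 1 (λ φ → φ :^ 12 := (φ :^ 2) :^ 5 :* (φ :* φ)) refl φ) ⟩
        U ((φ ^ 2) ^ 5 * (φ * φ))
          ≈⟨ U-^5-* (φ ^ 2) (φ * φ) ⟩
        φ ^ 2 * U (φ * φ)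
          ≈⟨ solve 3 (λ φ u v → φ :^ 2 :* u := φ :^ 2 :* (u :+ v) :- φ :^ 2 :* v)
               refl φ (U (φ * φ)) ((φ * φ) ^ 5) ⟩
        φ ^ 2 * (U (φ * φ) + (φ * φ) ^ 5) - φ ^ 2 * (φ * φ) ^ 5
          ≈⟨ +-congʳ (*-congˡ U-φ²) ⟩
        φ ^ 2 * (⟦ 2F ⟧ * (φ * φ)) - φ ^ 2 * (φ * φ) ^ 5
          ≈⟨ solve 1 (λ φ → φ :^ 2 :* (con 2F :* (φ :* φ)) :- φ :^ 2 :* (φ :* φ) :^ 5
               := con 2F :* φ :^ 4 :- φ :^ 12) refl φ ⟩
        ⟦ 2F ⟧ * φ ^ 4 - φ ^ 12 ∎

      U²-φ¹² : U (U (φ ^ 12)) ≈ φ ^ 12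
      U²-φ¹² = begin
        U (U (φ ^ 12))
          -- Constants of F₅ are their own fifth powers, so `U-^5-*` moves them out of U.
          ≈⟨ U-cong (trans U-φ¹² (solve 1 (λ φ → con 2F :* φ :^ 4 :- φ :^ 12
               := con 2F :^ 5 :* φ :^ 4 :+ con 4F :^ 5 :* φ :^ 12) refl φ)) ⟩
        U (⟦ 2F ⟧ ^ 5 * φ ^ 4 + ⟦ 4F ⟧ ^ 5 * φ ^ 12)
          ≈⟨ U-+ _ _ ⟩
        U (⟦ 2F ⟧ ^ 5 * φ ^ 4) + U (⟦ 4F ⟧ ^ 5 * φ ^ 12)
          ≈⟨ +-cong (U-^5-* ⟦ 2F ⟧ (φ ^ 4)) (U-^5-* ⟦ 4F ⟧ (φ ^ 12)) ⟩
        ⟦ 2F ⟧ * U (φ ^ 4) + ⟦ 4F ⟧ * U (φ ^ 12)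
          ≈⟨ +-cong (*-congˡ U-φ⁴) (*-congˡ U-φ¹²) ⟩
        ⟦ 2F ⟧ * φ ^ 4 + ⟦ 4F ⟧ * (⟦ 2F ⟧ * φ ^ 4 - φ ^ 12)
          ≈⟨ solve 1 (λ φ → con 2F :* φ :^ 4 :+ con 4F :* (con 2F :* φ :^ 4 :- φ :^ 12) := φ :^ 12) refl φ ⟩
        φ ^ 12 ∎

      U²-φ¹²⁴ : ∀ f → f ≈ (((φ ^ 4) ^ 5) ^ 5 * (φ ^ 4) ^ 5) * φ ^ 4 → U (U f) ≈ φ ^ 12
      U²-φ¹²⁴ f f≈ = begin
        U (U f)
          ≈⟨ U-cong (U-cong (trans f≈ (*-congʳ (sym (frobenius-* ((φ ^ 4) ^ 5) (φ ^ 4)))))) ⟩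
        U (U (((φ ^ 4) ^ 5 * φ ^ 4) ^ 5 * φ ^ 4))
          ≈⟨ U-cong (U-^5-* _ (φ ^ 4)) ⟩
        U ((φ ^ 4) ^ 5 * φ ^ 4 * U (φ ^ 4))
          ≈⟨ U-cong (*-congˡ U-φ⁴) ⟩
        U ((φ ^ 4) ^ 5 * φ ^ 4 * φ ^ 4)
          ≈⟨ U-cong (solve 1 (λ φ → (φ :^ 4) :^ 5 :* φ :^ 4 :* φ :^ 4 := (φ :^ 4) :^ 5 :* φ :^ 8) refl φ) ⟩
        U ((φ ^ 4) ^ 5 * φ ^ 8)
          ≈⟨ U-^5-* (φ ^ 4) (φ ^ 8) ⟩
        φ ^ 4 * U (φ ^ 8)
          ≈⟨ *-congˡ U-φ⁸ ⟩
        φ ^ 4 * φ ^ 8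
          ≈⟨ solve 1 (λ φ → φ :^ 4 :* φ :^ 8 := φ :^ 12) refl φ ⟩
        φ ^ 12 ∎

      U²≈U⁴ : ∀ f → f ≈ (((φ ^ 4) ^ 5) ^ 5 * (φ ^ 4) ^ 5) * φ ^ 4 → U (U f) ≈ U (U (U (U f)))
      U²≈U⁴ f f≈ = begin
        U (U f)           ≈⟨ U²-φ¹²⁴ f f≈ ⟩
        φ ^ 12            ≈⟨ U²-φ¹² ⟨
        U (U (φ ^ 12))    ≈⟨ U-cong (U-cong (U²-φ¹²⁴ f f≈)) ⟨
        U (U (U (U f)))   ∎

-- Counting lattice points

module _ {I : Set} where

  count : {P : I → Set} → Decidable P → List I → ℕ
  count P? xs = length (filter P? xs)

  count-split : ∀ {P Q : I → Set} (P? : Decidable P) (Q? : Decidable Q) xs →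
    count P? xs ≡ count (λ i → P? i ×-dec Q? i) xs ℕ.+ count (λ i → P? i ×-dec ¬? (Q? i)) xs
  count-split P? Q? [] = ≡.refl
  count-split P? Q? (x ∷ xs) with P? x | Q? x
  ... | yes _ | yes _ = ≡.cong suc (count-split P? Q? xs)
  ... | yes _ | no _  = ≡.trans (≡.cong suc (count-split P? Q? xs)) (≡.sym (ℕ.+-suc _ _))
  ... | no _  | yes _ = count-split P? Q? xs
  ... | no _  | no _  = count-split P? Q? xs

  count-none : ∀ {P : I → Set} (P? : Decidable P) → (∀ i → ¬ P i) → ∀ xs → count P? xs ≡ 0
  count-none P? ¬P []       = ≡.refl
  count-none P? ¬P (x ∷ xs) = ≡.trans (≡.cong length (filter-reject P? (¬P x))) (count-none P? ¬P xs)

  -- Mapping f over the elements satisfying P gives a duplicate-free list with the same members as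
  -- the list for Q, hence a permutation of it. The map f may leave xs, so both predicates are
  -- required to have all their solutions in xs.
  count-bijection : ∀ {P Q : I → Set} (P? : Decidable P) (Q? : Decidable Q) {xs} → Unique xs →
    (∀ i → P i → i ∈ xs) → (∀ i → Q i → i ∈ xs) →
    (f : I → I) → (∀ {i j} → f i ≡ f j → i ≡ j) → (∀ i → P i → Q (f i)) →
    (∀ j → Q j → ∃ λ i → P i × j ≡ f i) → count P? xs ≡ count Q? xs
  count-bijection P? Q? {xs} unique P⊆ Q⊆ f f-inj to from = begin
    length (filter P? xs)          ≡⟨ length-map f (filter P? xs) ⟨
    length (map f (filter P? xs))  ≡⟨ ↭-length (∼bag⇒↭ (unique∧set⇒bag
                                        (Unique.map⁺ f-inj (Unique.filter⁺ P? unique))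
                                        (Unique.filter⁺ Q? unique) (mk⇔ ⊆ ⊇))) ⟩
    length (filter Q? xs)          ∎
    where
    open ≡.≡-Reasoning
    ⊆ : ∀ {j} → j ∈ map f (filter P? xs) → j ∈ filter Q? xs
    ⊆ j∈ with ∈-map⁻ f j∈
    ... | i , i∈ , ≡.refl = let Qfi = to i (proj₂ (∈-filter⁻ P? {xs = xs} i∈)) in ∈-filter⁺ Q? (Q⊆ _ Qfi) Qfi
    ⊇ : ∀ {j} → j ∈ filter Q? xs → j ∈ map f (filter P? xs)
    ⊇ {j} j∈ with from j (proj₂ (∈-filter⁻ Q? {xs = xs} j∈))
    ... | i , Pi , ≡.refl = ∈-map⁺ f (∈-filter⁺ P? (P⊆ i Pi) Pi)

-- The order puts n + 1 and -(n + 1) in front, so that enlarging the range adds two equal terms to a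
-- theta sum.
ints : ℕ → List ℤ
ints zero    = + 0 ∷ []
ints (suc n) = + suc n ∷ -[1+ n ] ∷ ints n

ints-≤ : ∀ n → All (λ x → ∣ x ∣ ℕ.≤ n) (ints n)
ints-≤ zero    = ℕ.z≤n ∷ []
ints-≤ (suc n) = ℕ.≤-refl ∷ ℕ.≤-refl ∷ All.map ℕ.m≤n⇒m≤1+n (ints-≤ n)

ints-unique : ∀ n → Unique (ints n)
ints-unique zero    = [] ∷ []
ints-unique (suc n) =
  ((λ ()) ∷ All.map (λ { ∣x∣≤n ≡.refl → ℕ.1+n≰n ∣x∣≤n }) (ints-≤ n))
  ∷ All.map (λ { ∣x∣≤n ≡.refl → ℕ.1+n≰n ∣x∣≤n }) (ints-≤ n)
  ∷ ints-unique n

∈-ints : ∀ n x → ∣ x ∣ ℕ.≤ n → x ∈ ints n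
∈-ints zero    (+ zero) ℕ.z≤n = here ≡.refl
∈-ints (suc n) x ∣x∣≤ with ℕ.m≤n⇒m<n∨m≡n ∣x∣≤
... | inj₁ (ℕ.s≤s ∣x∣≤n) = there (there (∈-ints n x ∣x∣≤n))
∈-ints (suc n) (+ .(suc n))  _ | inj₂ ≡.refl = here ≡.refl
∈-ints (suc n) (-[1+ .n ]) _ | inj₂ ≡.refl = there (here ≡.refl)

abstract
  prime-5 : Prime 5
  prime-5 = from-yes (prime? 5)

square : ℤ → ℕ
square x = ∣ x ∣ ℕ.* ∣ x ∣

norm : ℤ × ℤ → ℕ
norm (x , y) = square x ℕ.+ square y

∣x∣≤square : ∀ x → ∣ x ∣ ℕ.≤ square x
∣x∣≤square x with ∣ x ∣
... | zero  = ℕ.z≤n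
... | suc n = ℕ.m≤m*n (suc n) (suc n)

square-∈ : ∀ {N} x → square x ℕ.≤ N → x ∈ ints N
square-∈ x x²≤N = ∈-ints _ x (ℕ.≤-trans (∣x∣≤square x) x²≤N)

box : ℕ → List (ℤ × ℤ)
box N = cartesianProduct (ints N) (ints N)

norm-∈ : ∀ {N} z → norm z ℕ.≤ N → z ∈ box N
norm-∈ (x , y) ≤N = ∈-cartesianProduct⁺
  (square-∈ x (ℕ.≤-trans (ℕ.m≤m+n (square x) _) ≤N)) (square-∈ y (ℕ.≤-trans (ℕ.m≤n+m _ (square x)) ≤N))

box-unique : ∀ N → Unique (box N)
box-unique N = Unique.cartesianProduct⁺ (ints-unique N) (ints-unique N)

+-square : ∀ x → + square x ≡ x ℤ.* x
+-square (+ n)    = ℤ.pos-* n n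
+-square -[1+ n ] = ≡.refl

+-norm : ∀ x y → + norm (x , y) ≡ x ℤ.* x ℤ.+ y ℤ.* y
+-norm x y = ≡.trans (ℤ.pos-+ (square x) (square y)) (≡.cong₂ ℤ._+_ (+-square x) (+-square y))

-- Multiplication by 2 + i and by 2 - i.
mul mul′ : ℤ × ℤ → ℤ × ℤ
mul  (u , v) = + 2 ℤ.* u ℤ.- v , u ℤ.+ + 2 ℤ.* v
mul′ (u , v) = + 2 ℤ.* u ℤ.+ v , + 2 ℤ.* v ℤ.- u

module _ where
  open +-*-Solver
  open ≡.≡-Reasoning

  norm-mul : ∀ z → norm (mul z) ≡ norm z ℕ.* 5
  norm-mul (u , v) = ℤ.+-injective (begin
    + norm (mul (u , v))                  ≡⟨ +-norm (proj₁ (mul (u , v))) (proj₂ (mul (u , v))) ⟩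
    _                                     ≡⟨ solve 2 (λ u v →
      (con (+ 2) :* u :- v) :* (con (+ 2) :* u :- v) :+ (u :+ con (+ 2) :* v) :* (u :+ con (+ 2) :* v)
      := (u :* u :+ v :* v) :* con (+ 5)) ≡.refl u v ⟩
    (u ℤ.* u ℤ.+ v ℤ.* v) ℤ.* + 5         ≡⟨ ≡.cong (ℤ._* + 5) (+-norm u v) ⟨
    + norm (u , v) ℤ.* + 5                ≡⟨ ℤ.pos-* (norm (u , v)) 5 ⟨
    + (norm (u , v) ℕ.* 5)                ∎)

  norm-mul′ : ∀ z → norm (mul′ z) ≡ norm z ℕ.* 5
  norm-mul′ (u , v) = ℤ.+-injective (begin
    + norm (mul′ (u , v))                 ≡⟨ +-norm (proj₁ (mul′ (u , v))) (proj₂ (mul′ (u , v))) ⟩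
    _                                     ≡⟨ solve 2 (λ u v →
      (con (+ 2) :* u :+ v) :* (con (+ 2) :* u :+ v) :+ (con (+ 2) :* v :- u) :* (con (+ 2) :* v :- u)
      := (u :* u :+ v :* v) :* con (+ 5)) ≡.refl u v ⟩
    (u ℤ.* u ℤ.+ v ℤ.* v) ℤ.* + 5         ≡⟨ ≡.cong (ℤ._* + 5) (+-norm u v) ⟨
    + norm (u , v) ℤ.* + 5                ≡⟨ ℤ.pos-* (norm (u , v)) 5 ⟨
    + (norm (u , v) ℕ.* 5)                ∎)

  -- Multiplying by the conjugate 2 - i recovers 5 u and 5 v.
  mul-injective : ∀ {z w} → mul z ≡ mul w → z ≡ w
  mul-injective {u , v} {u′ , v′} eq = ≡.cong₂ _,_
    (ℤ.*-cancelʳ-≡ u u′ (+ 5) (begin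
      u ℤ.* + 5
        ≡⟨ solve 2 (λ u v → u :* con (+ 5)
             := con (+ 2) :* (con (+ 2) :* u :- v) :+ (u :+ con (+ 2) :* v)) ≡.refl u v ⟩
      + 2 ℤ.* proj₁ (mul (u , v)) ℤ.+ proj₂ (mul (u , v))
        ≡⟨ ≡.cong (λ z → + 2 ℤ.* proj₁ z ℤ.+ proj₂ z) eq ⟩
      + 2 ℤ.* proj₁ (mul (u′ , v′)) ℤ.+ proj₂ (mul (u′ , v′))
        ≡⟨ solve 2 (λ u v → con (+ 2) :* (con (+ 2) :* u :- v) :+ (u :+ con (+ 2) :* v)
             := u :* con (+ 5)) ≡.refl u′ v′ ⟩
      u′ ℤ.* + 5 ∎))
    (ℤ.*-cancelʳ-≡ v v′ (+ 5) (begin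
      v ℤ.* + 5
        ≡⟨ solve 2 (λ u v → v :* con (+ 5)
             := con (+ 2) :* (u :+ con (+ 2) :* v) :- (con (+ 2) :* u :- v)) ≡.refl u v ⟩
      + 2 ℤ.* proj₂ (mul (u , v)) ℤ.- proj₁ (mul (u , v))
        ≡⟨ ≡.cong (λ z → + 2 ℤ.* proj₂ z ℤ.- proj₁ z) eq ⟩
      + 2 ℤ.* proj₂ (mul (u′ , v′)) ℤ.- proj₁ (mul (u′ , v′))
        ≡⟨ solve 2 (λ u v → con (+ 2) :* (u :+ con (+ 2) :* v) :- (con (+ 2) :* u :- v)
             := v :* con (+ 5)) ≡.refl u′ v′ ⟩
      v′ ℤ.* + 5 ∎))

  mul′-injective : ∀ {z w} → mul′ z ≡ mul′ w → z ≡ w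
  mul′-injective {u , v} {u′ , v′} eq = ≡.cong₂ _,_
    (ℤ.*-cancelʳ-≡ u u′ (+ 5) (begin
      u ℤ.* + 5
        ≡⟨ solve 2 (λ u v → u :* con (+ 5)
             := con (+ 2) :* (con (+ 2) :* u :+ v) :- (con (+ 2) :* v :- u)) ≡.refl u v ⟩
      + 2 ℤ.* proj₁ (mul′ (u , v)) ℤ.- proj₂ (mul′ (u , v))
        ≡⟨ ≡.cong (λ z → + 2 ℤ.* proj₁ z ℤ.- proj₂ z) eq ⟩
      + 2 ℤ.* proj₁ (mul′ (u′ , v′)) ℤ.- proj₂ (mul′ (u′ , v′))
        ≡⟨ solve 2 (λ u v → con (+ 2) :* (con (+ 2) :* u :+ v) :- (con (+ 2) :* v :- u)
             := u :* con (+ 5)) ≡.refl u′ v′ ⟩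
      u′ ℤ.* + 5 ∎))
    (ℤ.*-cancelʳ-≡ v v′ (+ 5) (begin
      v ℤ.* + 5
        ≡⟨ solve 2 (λ u v → v :* con (+ 5)
             := con (+ 2) :* (con (+ 2) :* v :- u) :+ (con (+ 2) :* u :+ v)) ≡.refl u v ⟩
      + 2 ℤ.* proj₂ (mul′ (u , v)) ℤ.+ proj₁ (mul′ (u , v))
        ≡⟨ ≡.cong (λ z → + 2 ℤ.* proj₂ z ℤ.+ proj₁ z) eq ⟩
      + 2 ℤ.* proj₂ (mul′ (u′ , v′)) ℤ.+ proj₁ (mul′ (u′ , v′))
        ≡⟨ solve 2 (λ u v → con (+ 2) :* (con (+ 2) :* v :- u) :+ (con (+ 2) :* u :+ v)
             := v :* con (+ 5)) ≡.refl u′ v′ ⟩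
      v′ ℤ.* + 5 ∎))

  -- x + y i is a multiple of 2 + i if and only if 5 divides 2 x + y.
  2+i∣_ : ℤ × ℤ → Set
  2+i∣ (x , y) = + 5 ℤ.∣ + 2 ℤ.* x ℤ.+ y

  2+i∣?_ : Decidable 2+i∣_
  2+i∣? (x , y) = + 5 ℤ.∣? + 2 ℤ.* x ℤ.+ y

  2+i∣mul : ∀ z → 2+i∣ mul z
  2+i∣mul (u , v) = ℤ.divides u (solve 2 (λ u v →
    con (+ 2) :* (con (+ 2) :* u :- v) :+ (u :+ con (+ 2) :* v) := u :* con (+ 5)) ≡.refl u v)

  -- The real part of (2 - i)(x + y i) is 2 x + y = 5 u, so the quotient has real part u; its
  -- imaginary part is forced by x = 2 u - v.
  2+i∣⇒mul : ∀ z → 2+i∣ z → ∃ λ w → z ≡ mul w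
  2+i∣⇒mul (x , y) (ℤ.divides u eq) = (u , + 2 ℤ.* u ℤ.- x) , ≡.cong₂ _,_
    (solve 2 (λ x u → x := con (+ 2) :* u :- (con (+ 2) :* u :- x)) ≡.refl x u)
    (begin
      y                                      ≡⟨ solve 2 (λ x y → y := con (+ 2) :* x :+ y :- con (+ 2) :* x) ≡.refl x y ⟩
      + 2 ℤ.* x ℤ.+ y ℤ.- + 2 ℤ.* x          ≡⟨ ≡.cong (ℤ._- + 2 ℤ.* x) eq ⟩
      u ℤ.* + 5 ℤ.- + 2 ℤ.* x                ≡⟨ solve 2 (λ x u → u :* con (+ 5) :- con (+ 2) :* x
                                                  := u :+ con (+ 2) :* (con (+ 2) :* u :- x)) ≡.refl x u ⟩
      u ℤ.+ + 2 ℤ.* (+ 2 ℤ.* u ℤ.- x)        ∎)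

  -- The values of 2 x + y at `mul′ (u , v)` and at `(u , v)` add up to 5 (u + v), so 5 divides both
  -- or neither. This expresses that 2 - i is prime to 2 + i.
  2+i∣mul′⇒2+i∣ : ∀ z → 2+i∣ mul′ z → 2+i∣ z
  2+i∣mul′⇒2+i∣ (u , v) (ℤ.divides k eq) = ℤ.divides (u ℤ.+ v ℤ.- k) (begin
    + 2 ℤ.* u ℤ.+ v
      ≡⟨ solve 2 (λ u v → con (+ 2) :* u :+ v
           := (u :+ v) :* con (+ 5) :- (con (+ 2) :* (con (+ 2) :* u :+ v) :+ (con (+ 2) :* v :- u)))
           ≡.refl u v ⟩
    (u ℤ.+ v) ℤ.* + 5 ℤ.- (+ 2 ℤ.* (+ 2 ℤ.* u ℤ.+ v) ℤ.+ (+ 2 ℤ.* v ℤ.- u))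
      ≡⟨ ≡.cong (λ t → (u ℤ.+ v) ℤ.* + 5 ℤ.- t) eq ⟩
    (u ℤ.+ v) ℤ.* + 5 ℤ.- k ℤ.* + 5
      ≡⟨ solve 2 (λ s k → s :* con (+ 5) :- k :* con (+ 5) := (s :- k) :* con (+ 5)) ≡.refl (u ℤ.+ v) k ⟩
    (u ℤ.+ v ℤ.- k) ℤ.* + 5 ∎)

  2+i∣⇒2+i∣mul′ : ∀ z → 2+i∣ z → 2+i∣ mul′ z
  2+i∣⇒2+i∣mul′ (u , v) (ℤ.divides k eq) = ℤ.divides (u ℤ.+ v ℤ.- k) (begin
    + 2 ℤ.* (+ 2 ℤ.* u ℤ.+ v) ℤ.+ (+ 2 ℤ.* v ℤ.- u)
      ≡⟨ solve 2 (λ u v → con (+ 2) :* (con (+ 2) :* u :+ v) :+ (con (+ 2) :* v :- u)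
           := (u :+ v) :* con (+ 5) :- (con (+ 2) :* u :+ v)) ≡.refl u v ⟩
    (u ℤ.+ v) ℤ.* + 5 ℤ.- (+ 2 ℤ.* u ℤ.+ v)
      ≡⟨ ≡.cong (λ t → (u ℤ.+ v) ℤ.* + 5 ℤ.- t) eq ⟩
    (u ℤ.+ v) ℤ.* + 5 ℤ.- k ℤ.* + 5
      ≡⟨ solve 2 (λ s k → s :* con (+ 5) :- k :* con (+ 5) := (s :- k) :* con (+ 5)) ≡.refl (u ℤ.+ v) k ⟩
    (u ℤ.+ v ℤ.- k) ℤ.* + 5 ∎)

  2-i∣⇒mul′ : ∀ x y → + 5 ℤ.∣ + 2 ℤ.* x ℤ.- y → ∃ λ w → (x , y) ≡ mul′ w
  2-i∣⇒mul′ x y (ℤ.divides u eq) = (u , x ℤ.- + 2 ℤ.* u) , ≡.cong₂ _,_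
    (solve 2 (λ x u → x := con (+ 2) :* u :+ (x :- con (+ 2) :* u)) ≡.refl x u)
    (begin
      y                                      ≡⟨ solve 2 (λ x y → y := con (+ 2) :* x :- (con (+ 2) :* x :- y)) ≡.refl x y ⟩
      + 2 ℤ.* x ℤ.- (+ 2 ℤ.* x ℤ.- y)        ≡⟨ ≡.cong (λ t → + 2 ℤ.* x ℤ.- t) eq ⟩
      + 2 ℤ.* x ℤ.- u ℤ.* + 5                ≡⟨ solve 2 (λ x u → con (+ 2) :* x :- u :* con (+ 5)
                                                  := con (+ 2) :* (x :- con (+ 2) :* u) :- u) ≡.refl x u ⟩
      + 2 ℤ.* (x ℤ.- + 2 ℤ.* u) ℤ.- u        ∎)

  -- Since (2 x + y)(2 x - y) = 5 x² - (x² + y²), the prime 5 divides one of the two factors, and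
  -- the first is excluded.
  5∣norm⇒mul′ : ∀ z m → norm z ≡ m ℕ.* 5 → ¬ 2+i∣ z → ∃ λ w → z ≡ mul′ w
  5∣norm⇒mul′ (x , y) m eq ∤z = 2-i∣⇒mul′ x y (ℤ.∣ᵤ⇒∣ ([ (λ d → contradiction (ℤ.∣ᵤ⇒∣ d) ∤z) , id ]′
    (euclidsLemma ∣ + 2 ℤ.* x ℤ.+ y ∣ ∣ + 2 ℤ.* x ℤ.- y ∣ prime-5
      (≡.subst (5 ∣_) (ℤ.abs-* (+ 2 ℤ.* x ℤ.+ y) (+ 2 ℤ.* x ℤ.- y)) (ℤ.∣⇒∣ᵤ 5∣product)))))
    where
    5∣product : + 5 ℤ.∣ (+ 2 ℤ.* x ℤ.+ y) ℤ.* (+ 2 ℤ.* x ℤ.- y)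
    5∣product = ℤ.divides (x ℤ.* x ℤ.- + m) (begin
      (+ 2 ℤ.* x ℤ.+ y) ℤ.* (+ 2 ℤ.* x ℤ.- y)
        ≡⟨ solve 2 (λ x y → (con (+ 2) :* x :+ y) :* (con (+ 2) :* x :- y)
             := x :* x :* con (+ 5) :- (x :* x :+ y :* y)) ≡.refl x y ⟩
      x ℤ.* x ℤ.* + 5 ℤ.- (x ℤ.* x ℤ.+ y ℤ.* y)
        ≡⟨ ≡.cong (λ t → x ℤ.* x ℤ.* + 5 ℤ.- t) (≡.trans (≡.sym (+-norm x y)) (≡.trans (≡.cong +_ eq) (ℤ.pos-* m 5))) ⟩
      x ℤ.* x ℤ.* + 5 ℤ.- + m ℤ.* + 5
        ≡⟨ solve 2 (λ s k → s :* con (+ 5) :- k :* con (+ 5) := (s :- k) :* con (+ 5)) ≡.refl (x ℤ.* x) (+ m) ⟩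
      (x ℤ.* x ℤ.- + m) ℤ.* + 5 ∎)

norm≟ : ∀ m → Decidable (λ z → norm z ≡ m)
norm≟ m z = norm z ℕ.≟ m

square≟ : ∀ m → Decidable (λ x → square x ≡ m)
square≟ m x = square x ℕ.≟ m

normMult≟ : ∀ m → Decidable (λ z → norm z ≡ m × 2+i∣ z)
normMult≟ m z = norm≟ m z ×-dec 2+i∣? z

normNonMult≟ : ∀ m → Decidable (λ z → norm z ≡ m × ¬ 2+i∣ z)
normNonMult≟ m z = norm≟ m z ×-dec ¬? (2+i∣? z)

NonresidueMod₅ : ℕ → Set
NonresidueMod₅ r = ∀ (s : Fin 5) → (toℕ s ℕ.* toℕ s) ℕ.% 5 ≢ r ℕ.% 5

nonresidueMod₅? : Decidable NonresidueMod₅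
nonresidueMod₅? r = all? λ s → ¬? ((toℕ s ℕ.* toℕ s) ℕ.% 5 ℕ.≟ r ℕ.% 5)

module _ (N : ℕ) where

  private
    box-⊇ : ∀ {m} {X : ℤ × ℤ → Set} → m ℕ.≤ N → ∀ z → norm z ≡ m × X z → z ∈ box N
    box-⊇ m≤N z (≡.refl , _) = norm-∈ z m≤N

  count-mult : ∀ m → m ℕ.* 5 ℕ.≤ N → count (norm≟ m) (box N) ≡ count (normMult≟ (m ℕ.* 5)) (box N)
  count-mult m m*5≤N = count-bijection (norm≟ m) (normMult≟ (m ℕ.* 5)) (box-unique N)
    (λ { z ≡.refl → norm-∈ z (ℕ.≤-trans (ℕ.m≤m*n m 5) m*5≤N) }) (box-⊇ m*5≤N)
    mul mul-injective (λ { z ≡.refl → norm-mul z , 2+i∣mul z }) from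
    where
    from : ∀ z → norm z ≡ m ℕ.* 5 × 2+i∣ z → ∃ λ w → norm w ≡ m × z ≡ mul w
    from z (eq , d) with 2+i∣⇒mul z d
    ... | w , ≡.refl = w , ℕ.*-cancelʳ-≡ (norm w) m 5 (≡.trans (≡.sym (norm-mul w)) eq) , ≡.refl

  -- The bijection is multiplication by 2 - i: it preserves non-divisibility by 2 + i, and by
  -- `5∣norm⇒mul′` it reaches every element counted on the right.
  count-nonMult : ∀ m → m ℕ.* 5 ℕ.≤ N →
    count (normNonMult≟ m) (box N) ≡ count (normNonMult≟ (m ℕ.* 5)) (box N)
  count-nonMult m m*5≤N = count-bijection (normNonMult≟ m) (normNonMult≟ (m ℕ.* 5)) (box-unique N)
    (box-⊇ (ℕ.≤-trans (ℕ.m≤m*n m 5) m*5≤N)) (box-⊇ m*5≤N)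
    mul′ mul′-injective (λ { z (≡.refl , ∤z) → norm-mul′ z , λ d → ∤z (2+i∣mul′⇒2+i∣ z d) }) from
    where
    from : ∀ z → norm z ≡ m ℕ.* 5 × ¬ 2+i∣ z → ∃ λ w → (norm w ≡ m × ¬ 2+i∣ w) × z ≡ mul′ w
    from z (eq , ∤z) = go eq ∤z (5∣norm⇒mul′ z m eq ∤z)
      where
      go : ∀ {z} → norm z ≡ m ℕ.* 5 → ¬ 2+i∣ z → (∃ λ w → z ≡ mul′ w) →
        ∃ λ w → (norm w ≡ m × ¬ 2+i∣ w) × z ≡ mul′ w
      go eq ∤z (w , ≡.refl) =
        w , (ℕ.*-cancelʳ-≡ (norm w) m 5 (≡.trans (≡.sym (norm-mul′ w)) eq) , λ d → ∤z (2+i∣⇒2+i∣mul′ w d)) , ≡.refl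

  count-mult-∤ : ∀ m → ¬ 5 ∣ m → count (normMult≟ m) (box N) ≡ 0
  count-mult-∤ m ∤m = count-none (normMult≟ m) none (box N)
    where
    none : ∀ z → ¬ (norm z ≡ m × 2+i∣ z)
    none z (≡.refl , d) with 2+i∣⇒mul z d
    ... | w , ≡.refl = ∤m (divides (norm w) (norm-mul w))

  -- Among the elements of norm 5 m, the multiples of 2 + i match all elements of norm m, and the
  -- others match the non-multiples of norm m; adding the multiples of norm m completes the second
  -- count. With `count-mult` this is the Hecke relation r(5m) + r(m/5) = 2 r(m) for sums of two
  -- squares.
  count-norm : ∀ m → m ℕ.* 5 ℕ.≤ N →
    count (norm≟ (m ℕ.* 5)) (box N) ℕ.+ count (normMult≟ m) (box N) ≡
    count (norm≟ m) (box N) ℕ.+ count (norm≟ m) (box N)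
  count-norm m m*5≤N = begin
    count (norm≟ (m ℕ.* 5)) (box N) ℕ.+ c₁
      ≡⟨ ≡.cong (ℕ._+ c₁) (count-split (norm≟ (m ℕ.* 5)) 2+i∣?_ (box N)) ⟩
    count (normMult≟ (m ℕ.* 5)) (box N) ℕ.+ count (normNonMult≟ (m ℕ.* 5)) (box N) ℕ.+ c₁
      ≡⟨ ≡.cong₂ (λ a b → a ℕ.+ b ℕ.+ c₁) (count-mult m m*5≤N) (count-nonMult m m*5≤N) ⟨
    c ℕ.+ c₂ ℕ.+ c₁
      ≡⟨ ℕ.+-assoc c c₂ c₁ ⟩
    c ℕ.+ (c₂ ℕ.+ c₁)
      ≡⟨ ≡.cong (c ℕ.+_) (≡.trans (ℕ.+-comm c₂ c₁) (≡.sym (count-split (norm≟ m) 2+i∣?_ (box N)))) ⟩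
    c ℕ.+ c ∎
    where
    open ≡.≡-Reasoning
    c = count (norm≟ m) (box N)
    c₁ = count (normMult≟ m) (box N)
    c₂ = count (normNonMult≟ m) (box N)

  -- The bijection is x ↦ 5 x, onto because 5 divides x as soon as it divides x².
  count-square : ∀ m → m ℕ.* 5 ℕ.* 5 ℕ.≤ N →
    count (square≟ m) (ints N) ≡ count (square≟ (m ℕ.* 5 ℕ.* 5)) (ints N)
  count-square m ≤N = count-bijection (square≟ m) (square≟ (m ℕ.* 5 ℕ.* 5)) (ints-unique N)
    (λ { x ≡.refl → square-∈ x (ℕ.≤-trans (ℕ.≤-trans (ℕ.m≤m*n m 5) (ℕ.m≤m*n (m ℕ.* 5) 5)) ≤N) })
    (λ { x eq → square-∈ x (≡.subst (ℕ._≤ N) (≡.sym eq) ≤N) })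
    (ℤ._* + 5) (λ {x} {y} → ℤ.*-cancelʳ-≡ x y (+ 5)) (λ { x ≡.refl → square-*5 x }) from
    where
    square-*5 : ∀ x → square (x ℤ.* + 5) ≡ square x ℕ.* 5 ℕ.* 5
    square-*5 x = begin
      ∣ x ℤ.* + 5 ∣ ℕ.* ∣ x ℤ.* + 5 ∣        ≡⟨ ≡.cong (λ t → t ℕ.* t) (ℤ.abs-* x (+ 5)) ⟩
      ∣ x ∣ ℕ.* 5 ℕ.* (∣ x ∣ ℕ.* 5)          ≡⟨ solve 1 (λ a → a :* con 5 :* (a :* con 5) := a :* a :* con 5 :* con 5) ≡.refl ∣ x ∣ ⟩
      square x ℕ.* 5 ℕ.* 5                   ∎
      where
      open ≡.≡-Reasoning
      open ℕ-Solver.+-*-Solver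
    from : ∀ x → square x ≡ m ℕ.* 5 ℕ.* 5 → ∃ λ y → square y ≡ m × x ≡ y ℤ.* + 5
    from x eq with ℤ.∣ᵤ⇒∣ {+ 5} {x} ([ id , id ]′ (euclidsLemma ∣ x ∣ ∣ x ∣ prime-5 (divides (m ℕ.* 5) eq)))
    ... | ℤ.divides y ≡.refl = y , ℕ.*-cancelʳ-≡ _ _ 5 (ℕ.*-cancelʳ-≡ _ _ 5 (≡.trans (≡.sym (square-*5 y)) eq)) , ≡.refl

  count-square-∤ : ∀ m → ¬ 5 ∣ m → count (square≟ (m ℕ.* 5)) (ints N) ≡ 0
  count-square-∤ m ∤m = count-none (square≟ (m ℕ.* 5)) none (ints N)
    where
    none : ∀ x → square x ≢ m ℕ.* 5
    none x eq with [ id , id ]′ (euclidsLemma ∣ x ∣ ∣ x ∣ prime-5 (divides m eq))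
    ... | divides k eq′ = ∤m (*-cancelʳ-∣ 5 (divides (k ℕ.* k) (begin
      m ℕ.* 5                    ≡⟨ eq ⟨
      ∣ x ∣ ℕ.* ∣ x ∣            ≡⟨ ≡.cong (λ t → t ℕ.* t) eq′ ⟩
      k ℕ.* 5 ℕ.* (k ℕ.* 5)      ≡⟨ solve 1 (λ a → a :* con 5 :* (a :* con 5) := a :* a :* con 25) ≡.refl k ⟩
      k ℕ.* k ℕ.* 25             ∎)))
      where
      open ≡.≡-Reasoning
      open ℕ-Solver.+-*-Solver

  count-square-nonresidue : ∀ r n → NonresidueMod₅ r →
    count (square≟ (r ℕ.+ n ℕ.* 5)) (ints N) ≡ 0
  count-square-nonresidue r n nonresidue = count-none (square≟ (r ℕ.+ n ℕ.* 5)) none (ints N)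
    where
    none : ∀ x → square x ≢ r ℕ.+ n ℕ.* 5
    none x eq = nonresidue (∣ x ∣ ℕ.mod 5) (begin
      (toℕ (∣ x ∣ ℕ.mod 5) ℕ.* toℕ (∣ x ∣ ℕ.mod 5)) ℕ.% 5
        ≡⟨ ≡.cong (λ t → (t ℕ.* t) ℕ.% 5) (toℕ-fromℕ< (ℕ.m%n<n ∣ x ∣ 5)) ⟩
      (∣ x ∣ ℕ.% 5 ℕ.* (∣ x ∣ ℕ.% 5)) ℕ.% 5
        ≡⟨ ℕ.%-distribˡ-* ∣ x ∣ ∣ x ∣ 5 ⟨
      square x ℕ.% 5
        ≡⟨ ≡.cong (ℕ._% 5) eq ⟩
      (r ℕ.+ n ℕ.* 5) ℕ.% 5
        ≡⟨ ℕ.[m+kn]%n≡m%n r n 5 ⟩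
      r ℕ.% 5 ∎)
      where open ≡.≡-Reasoning

-- Counting overpartitions by their largest part

Σ< : ℕ → (ℕ → ℕ) → ℕ
Σ< zero    f = 0
Σ< (suc n) f = f 0 ℕ.+ Σ< n (f ∘ suc)

Σ<-cong : ∀ n {f g} → f ≗ g → Σ< n f ≡ Σ< n g
Σ<-cong zero    p = ≡.refl
Σ<-cong (suc n) p = ≡.cong₂ ℕ._+_ (p 0) (Σ<-cong n (p ∘ suc))

length-concatMap : ∀ {A : Set} (g g′ : ℕ → List A) → (∀ j → g j ≡ g′ j) → ∀ f n →
  length (concatMap g (applyUpTo f n)) ≡ Σ< n (λ j → length (g′ (f j)))
length-concatMap g g′ p f zero    = ≡.refl
length-concatMap g g′ p f (suc n) = ≡.trans (length-++ (g (f 0)))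
  (≡.cong₂ ℕ._+_ (≡.cong length (p (f 0))) (length-concatMap g g′ p (f ∘ suc) n))

-- The contribution of multiplicity j + 1 of the part K to a count with total r.
atMultiplicity : (ℕ → ℕ) → ℕ → ℕ → ℕ → ℕ
atMultiplicity h K r j with suc j ℕ.* K ℕ.≤? r
... | no _  = 0
... | yes _ = h (r ℕ.∸ suc j ℕ.* K) ℕ.+ h (r ℕ.∸ suc j ℕ.* K)

length-double : ∀ {A B : Set} (f g : A → B) xs → length (map f xs ++ map g xs) ≡ length xs ℕ.+ length xs
length-double f g xs = ≡.trans (length-++ (map f xs)) (≡.cong₂ ℕ._+_ (length-map f xs) (length-map g xs))

partsCount : ℕ → ℕ → ℕ → ℕ
partsCount ℓ k r = length (overpartsUpTo ℓ k r)

partsCount-∣ : ∀ ℓ k r → ℓ ∣ suc k → partsCount ℓ (suc k) r ≡ partsCount ℓ k r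
partsCount-∣ ℓ k r d with ℓ ∣? suc k
... | yes _ = ≡.refl
... | no ∤d = contradiction d ∤d

-- A named copy of the local function `withMult` of `overpartsUpTo`, about which lemmas can be
-- stated.
withMultiplicity : ℕ → ℕ → ℕ → ℕ → List Overpartition
withMultiplicity ℓ k r j with suc j ℕ.* suc k ℕ.≤? r
... | no _  = []
... | yes _ =
  map ((suc k , suc j , true) ∷_) (overpartsUpTo ℓ k (r ℕ.∸ suc j ℕ.* suc k))
  ++ map ((suc k , suc j , false) ∷_) (overpartsUpTo ℓ k (r ℕ.∸ suc j ℕ.* suc k))

length-withMultiplicity : ∀ ℓ k r j →
  length (withMultiplicity ℓ k r j) ≡ atMultiplicity (partsCount ℓ k) (suc k) r j
length-withMultiplicity ℓ k r j with suc j ℕ.* suc k ℕ.≤? r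
... | no _  = ≡.refl
... | yes _ = length-double _ _ (overpartsUpTo ℓ k (r ℕ.∸ suc j ℕ.* suc k))

-- The left-hand side of withMult≡ is the local function of overpartsUpTo, which
-- has no name here; it is determined by its use in partsCount-∤.
mutual
  partsCount-∤ : ∀ ℓ k r → ¬ ℓ ∣ suc k →
    partsCount ℓ (suc k) r ≡ partsCount ℓ k r ℕ.+ Σ< r (atMultiplicity (partsCount ℓ k) (suc k) r)
  partsCount-∤ ℓ k r ∤d with ℓ ∣? suc k
  ... | yes d = contradiction d ∤d
  ... | no ∤d = ≡.trans (length-++ (overpartsUpTo ℓ k r)) (≡.cong (partsCount ℓ k r ℕ.+_)
    (≡.trans (length-concatMap _ (withMultiplicity ℓ k r) (withMult≡ ℓ k r ∤d) id r) (Σ<-cong r (length-withMultiplicity ℓ k r))))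

  withMult≡ : ∀ ℓ k r (∤d : ¬ ℓ ∣ suc k) j → _ ≡ withMultiplicity ℓ k r j
  withMult≡ ℓ k r ∤d j with suc j ℕ.* suc k ℕ.≤? r
  ... | no _  = ≡.refl
  ... | yes _ = ≡.refl

atMultiplicity-> : ∀ h K r j → r ℕ.< suc j ℕ.* K → atMultiplicity h K r j ≡ 0
atMultiplicity-> h K r j r< with suc j ℕ.* K ℕ.≤? r
... | yes ≤r = contradiction ≤r (ℕ.<⇒≱ r<)
... | no _   = ≡.refl

atMultiplicity-≤ : ∀ h K r j → suc j ℕ.* K ℕ.≤ r →
  atMultiplicity h K r j ≡ h (r ℕ.∸ suc j ℕ.* K) ℕ.+ h (r ℕ.∸ suc j ℕ.* K)
atMultiplicity-≤ h K r j ≤r with suc j ℕ.* K ℕ.≤? r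
... | yes _  = ≡.refl
... | no ≰r  = contradiction ≤r ≰r

-- Removing one copy of K lowers the multiplicity from j + 2 to j + 1 and the total from K + r to r.
atMultiplicity-suc : ∀ h K r j → atMultiplicity h K (K ℕ.+ r) (suc j) ≡ atMultiplicity h K r j
atMultiplicity-suc h K r j with suc j ℕ.* K ℕ.≤? r
... | yes ≤r = ≡.trans (atMultiplicity-≤ h K (K ℕ.+ r) (suc j) (ℕ.+-monoʳ-≤ K ≤r))
  (≡.cong (λ m → h m ℕ.+ h m) (ℕ.[m+n]∸[m+o]≡n∸o K r (suc j ℕ.* K)))
... | no ≰r = atMultiplicity-> h K (K ℕ.+ r) (suc j) (ℕ.+-monoʳ-< K (ℕ.≰⇒> ≰r))

Σ<-zero : ∀ n {f} → (∀ j → f j ≡ 0) → Σ< n f ≡ 0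
Σ<-zero zero    p = ≡.refl
Σ<-zero (suc n) p = ≡.cong₂ ℕ._+_ (p 0) (Σ<-zero n (p ∘ suc))

Σ<-extend : ∀ m n {f} → (∀ j → f (m ℕ.+ j) ≡ 0) → Σ< (m ℕ.+ n) f ≡ Σ< m f
Σ<-extend zero    n p = Σ<-zero n p
Σ<-extend (suc m) n {f} p = ≡.cong (f 0 ℕ.+_) (Σ<-extend m n p)

partsCount-< : ∀ ℓ k r → r ℕ.< suc k → partsCount ℓ (suc k) r ≡ partsCount ℓ k r
partsCount-< ℓ k r r<k = cases (ℓ ∣? suc k)
  where
  cases : Dec (ℓ ∣ suc k) → partsCount ℓ (suc k) r ≡ partsCount ℓ k r
  cases (yes d) = partsCount-∣ ℓ k r d
  cases (no ∤d) = ≡.trans (partsCount-∤ ℓ k r ∤d) (≡.trans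
    (≡.cong (partsCount ℓ k r ℕ.+_) (Σ<-zero r (λ j →
      atMultiplicity-> (partsCount ℓ k) (suc k) r j (ℕ.<-≤-trans r<k (ℕ.m≤m+n (suc k) (j ℕ.* suc k))))))
    (ℕ.+-identityʳ (partsCount ℓ k r)))

-- The coefficient of q^(K+r) in (1 - q^K) G′ = (1 + q^K) G, where K = k + 1 and G, G′ are the
-- generating functions for parts up to k and up to K. Multiplicity one contributes twice the count
-- for r; higher multiplicities lose one copy of K and, with one of these two counts, make up the
-- count for r with parts up to K.
partsCount-+ : ∀ ℓ k r → ¬ ℓ ∣ suc k → partsCount ℓ (suc k) (suc k ℕ.+ r) ≡
  partsCount ℓ k (suc k ℕ.+ r) ℕ.+ (partsCount ℓ k r ℕ.+ partsCount ℓ (suc k) r)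
partsCount-+ ℓ k r ∤d = ≡.trans (partsCount-∤ ℓ k (K ℕ.+ r) ∤d) (≡.cong (c (K ℕ.+ r) ℕ.+_) (begin
  at (K ℕ.+ r) 0 ℕ.+ Σ< (k ℕ.+ r) (at (K ℕ.+ r) ∘ suc)
    ≡⟨ ≡.cong₂ ℕ._+_ first (Σ<-cong (k ℕ.+ r) (atMultiplicity-suc c K r)) ⟩
  c r ℕ.+ c r ℕ.+ Σ< (k ℕ.+ r) (at r)
    ≡⟨ ≡.cong (λ n → c r ℕ.+ c r ℕ.+ Σ< n (at r)) (ℕ.+-comm k r) ⟩
  c r ℕ.+ c r ℕ.+ Σ< (r ℕ.+ k) (at r)
    -- From index r on the multiplicity exceeds r, so those terms are zero and the sum may stop at
    -- r.
    ≡⟨ ≡.cong (c r ℕ.+ c r ℕ.+_) (Σ<-extend r k (λ j → atMultiplicity-> c K r (r ℕ.+ j)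
         (ℕ.≤-trans (ℕ.s≤s (ℕ.m≤m+n r j)) (ℕ.m≤m*n (suc (r ℕ.+ j)) K)))) ⟩
  c r ℕ.+ c r ℕ.+ Σ< r (at r)
    ≡⟨ ℕ.+-assoc (c r) (c r) (Σ< r (at r)) ⟩
  c r ℕ.+ (c r ℕ.+ Σ< r (at r))
    ≡⟨ ≡.cong (c r ℕ.+_) (partsCount-∤ ℓ k r ∤d) ⟨
  c r ℕ.+ partsCount ℓ K r ∎))
  where
  open ≡.≡-Reasoning
  K = suc k
  c = partsCount ℓ k
  at = atMultiplicity c K
  first : at (K ℕ.+ r) 0 ≡ c r ℕ.+ c r
  first = ≡.trans
    (atMultiplicity-≤ c K (K ℕ.+ r) 0 (≡.subst (ℕ._≤ K ℕ.+ r) (≡.sym (ℕ.*-identityˡ K)) (ℕ.m≤m+n K r)))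
    (≡.cong (λ m → c m ℕ.+ c m) (≡.trans (≡.cong (K ℕ.+ r ℕ.∸_) (ℕ.*-identityˡ K)) (ℕ.m+n∸m≡n K r)))

partsCount-stable : ∀ ℓ {n k} → n ℕ.≤′ k → Abar ℓ n ≡ partsCount ℓ k n
partsCount-stable ℓ ℕ.≤′-refl           = ≡.refl
partsCount-stable ℓ (ℕ.≤′-step {k} n≤k) =
  ≡.trans (partsCount-stable ℓ n≤k) (≡.sym (partsCount-< ℓ k _ (ℕ.s≤s (ℕ.≤′⇒≤ n≤k))))

-- Power series over F₅

F₅-commutativeRing : CommutativeRing 0ℓ 0ℓ
F₅-commutativeRing = record
  { Carrier = F₅ ; _≈_ = _≡_ ; _+_ = _⊕_ ; _*_ = _⊗_ ; -_ = ⊖_ ; 0# = 0F ; 1# = 1F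
  ; isCommutativeRing = record
    { isRing = record
      { +-isAbelianGroup = record
        { isGroup = record
          { isMonoid = record
            { isSemigroup = record
              { isMagma = record { isEquivalence = ≡.isEquivalence ; ∙-cong = ≡.cong₂ _⊕_ }
              ; assoc = ⊕-assoc }
            ; identity = ⊕-identityˡ , λ x → ≡.trans (⊕-comm x 0F) (⊕-identityˡ x) }
          ; inverse = ⊖-inverseˡ , (λ x → ≡.trans (⊕-comm x (⊖ x)) (⊖-inverseˡ x))
          ; ⁻¹-cong = ≡.cong ⊖_ }
        ; comm = ⊕-comm }
      ; *-cong = ≡.cong₂ _⊗_
      ; *-assoc = ⊗-assoc
      ; *-identity = ⊗-identityˡ , (λ x → ≡.trans (⊗-comm x 1F) (⊗-identityˡ x))
      ; distrib = ⊗-distribˡ-⊕ , λ x y z → ≡.trans (⊗-comm (y ⊕ z) x)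
          (≡.trans (⊗-distribˡ-⊕ x y z) (≡.cong₂ _⊕_ (⊗-comm x y) (⊗-comm x z)))
      }
    ; *-comm = ⊗-comm
    }
  }

module F = CommutativeRing F₅-commutativeRing
open import Algebra.Properties.CommutativeSemigroup F.+-commutativeSemigroup using (interchange)
open import Algebra.Properties.Group F.+-group using (∙-cancelʳ)

Series : Set
Series = ℕ → F₅

infixl 6 _+ˢ_
infixl 7 _*ˢ_ _·ˢ_

const : F₅ → Series
const c zero    = c
const c (suc n) = 0F

-- The Cauchy product follows f = f 0 + q (f ∘ suc), which turns the ring laws into inductions on
-- the index of the coefficient.
_+ˢ_ _*ˢ_ : Series → Series → Series
(f +ˢ g) n = f n ⊕ g n
(f *ˢ g) zero    = f 0 ⊗ g 0
(f *ˢ g) (suc n) = f 0 ⊗ g (suc n) ⊕ ((f ∘ suc) *ˢ g) n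

_·ˢ_ : F₅ → Series → Series
(c ·ˢ f) n = c ⊗ f n

-ˢ_ : Series → Series
(-ˢ f) n = ⊖ f n

*ˢ-cong≤ : ∀ n {f f′ g g′} → (∀ i → i ℕ.≤ n → f i ≡ f′ i) → (∀ i → i ℕ.≤ n → g i ≡ g′ i) →
           (f *ˢ g) n ≡ (f′ *ˢ g′) n
*ˢ-cong≤ zero p q = ≡.cong₂ _⊗_ (p 0 ℕ.≤-refl) (q 0 ℕ.≤-refl)
*ˢ-cong≤ (suc n) p q = ≡.cong₂ _⊕_
  (≡.cong₂ _⊗_ (p 0 ℕ.z≤n) (q (suc n) ℕ.≤-refl))
  (*ˢ-cong≤ n (λ i i≤n → p (suc i) (ℕ.s≤s i≤n)) (λ i i≤n → q i (ℕ.m≤n⇒m≤1+n i≤n)))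

*ˢ-cong : ∀ {f f′ g g′} → f ≗ f′ → g ≗ g′ → f *ˢ g ≗ f′ *ˢ g′
*ˢ-cong p q n = *ˢ-cong≤ n (λ i _ → p i) (λ i _ → q i)

-- The mirror image of the defining recursion, splitting g instead of f. Comparing the two gives
-- commutativity.
*ˢ-suc : ∀ f g n → (f *ˢ g) (suc n) ≡ (f *ˢ (g ∘ suc)) n ⊕ f (suc n) ⊗ g 0
*ˢ-suc f g zero = ≡.refl
*ˢ-suc f g (suc n) = ≡.trans
  (≡.cong (f 0 ⊗ g (suc (suc n)) ⊕_) (*ˢ-suc (f ∘ suc) g n))
  (≡.sym (⊕-assoc (f 0 ⊗ g (suc (suc n))) _ _))

*ˢ-comm : ∀ f g → f *ˢ g ≗ g *ˢ f
*ˢ-comm f g zero = ⊗-comm (f 0) (g 0)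
*ˢ-comm f g (suc n) = begin
  f 0 ⊗ g (suc n) ⊕ ((f ∘ suc) *ˢ g) n  ≡⟨ ≡.cong₂ _⊕_ (⊗-comm (f 0) _) (*ˢ-comm (f ∘ suc) g n) ⟩
  g (suc n) ⊗ f 0 ⊕ (g *ˢ (f ∘ suc)) n  ≡⟨ ⊕-comm (g (suc n) ⊗ f 0) _ ⟩
  (g *ˢ (f ∘ suc)) n ⊕ g (suc n) ⊗ f 0  ≡⟨ *ˢ-suc g f n ⟨
  (g *ˢ f) (suc n)                      ∎
  where open ≡.≡-Reasoning

*ˢ-distribʳ : ∀ h f g → (f +ˢ g) *ˢ h ≗ f *ˢ h +ˢ g *ˢ h
*ˢ-distribʳ h f g zero = F.distribʳ (h 0) (f 0) (g 0)
*ˢ-distribʳ h f g (suc n) = ≡.trans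
  (≡.cong₂ _⊕_ (F.distribʳ (h (suc n)) (f 0) (g 0)) (*ˢ-distribʳ h (f ∘ suc) (g ∘ suc) n))
  (interchange (f 0 ⊗ h (suc n)) _ _ _)

·ˢ-*ˢ : ∀ c f g → (c ·ˢ f) *ˢ g ≗ c ·ˢ (f *ˢ g)
·ˢ-*ˢ c f g zero = ⊗-assoc c (f 0) (g 0)
·ˢ-*ˢ c f g (suc n) = ≡.trans
  (≡.cong₂ _⊕_ (⊗-assoc c (f 0) (g (suc n))) (·ˢ-*ˢ c (f ∘ suc) g n))
  (≡.sym (⊗-distribˡ-⊕ c (f 0 ⊗ g (suc n)) _))

*ˢ-assoc : ∀ f g h → (f *ˢ g) *ˢ h ≗ f *ˢ (g *ˢ h)
*ˢ-assoc f g h zero = ⊗-assoc (f 0) (g 0) (h 0)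
*ˢ-assoc f g h (suc n) = begin
  f 0 ⊗ g 0 ⊗ h (suc n) ⊕ ((f 0 ·ˢ (g ∘ suc) +ˢ (f ∘ suc) *ˢ g) *ˢ h) n
    ≡⟨ ≡.cong₂ _⊕_ (⊗-assoc (f 0) (g 0) (h (suc n))) (*ˢ-distribʳ h (f 0 ·ˢ (g ∘ suc)) ((f ∘ suc) *ˢ g) n) ⟩
  f 0 ⊗ (g 0 ⊗ h (suc n)) ⊕ (((f 0 ·ˢ (g ∘ suc)) *ˢ h) n ⊕ (((f ∘ suc) *ˢ g) *ˢ h) n)
    ≡⟨ ≡.cong (f 0 ⊗ (g 0 ⊗ h (suc n)) ⊕_) (≡.cong₂ _⊕_ (·ˢ-*ˢ (f 0) (g ∘ suc) h n) (*ˢ-assoc (f ∘ suc) g h n)) ⟩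
  f 0 ⊗ (g 0 ⊗ h (suc n)) ⊕ (f 0 ⊗ ((g ∘ suc) *ˢ h) n ⊕ ((f ∘ suc) *ˢ (g *ˢ h)) n)
    ≡⟨ ⊕-assoc (f 0 ⊗ (g 0 ⊗ h (suc n))) _ _ ⟨
  f 0 ⊗ (g 0 ⊗ h (suc n)) ⊕ f 0 ⊗ ((g ∘ suc) *ˢ h) n ⊕ ((f ∘ suc) *ˢ (g *ˢ h)) n
    ≡⟨ ≡.cong (_⊕ ((f ∘ suc) *ˢ (g *ˢ h)) n) (⊗-distribˡ-⊕ (f 0) (g 0 ⊗ h (suc n)) _) ⟨
  f 0 ⊗ (g *ˢ h) (suc n) ⊕ ((f ∘ suc) *ˢ (g *ˢ h)) n ∎
  where open ≡.≡-Reasoning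

*ˢ-zeroˡ : ∀ f → (λ _ → 0F) *ˢ f ≗ λ _ → 0F
*ˢ-zeroˡ f zero    = F.zeroˡ (f 0)
*ˢ-zeroˡ f (suc n) = ≡.cong₂ _⊕_ (F.zeroˡ (f (suc n))) (*ˢ-zeroˡ f n)

const-*ˢ : ∀ c f → const c *ˢ f ≗ c ·ˢ f
const-*ˢ c f zero    = ≡.refl
const-*ˢ c f (suc n) = ≡.trans (≡.cong (c ⊗ f (suc n) ⊕_) (*ˢ-zeroˡ f n)) (F.+-identityʳ (c ⊗ f (suc n)))

seriesRing : CommutativeRing 0ℓ 0ℓ
seriesRing = record
  { Carrier = Series ; _≈_ = _≗_ ; _+_ = _+ˢ_ ; _*_ = _*ˢ_ ; -_ = -ˢ_ ; 0# = const 0F ; 1# = const 1F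
  ; isCommutativeRing = record
    { isRing = record
      { +-isAbelianGroup = record
        { isGroup = record
          { isMonoid = record
            { isSemigroup = record
              { isMagma = record
                { isEquivalence = record
                  { refl = λ _ → ≡.refl ; sym = λ p n → ≡.sym (p n) ; trans = λ p q n → ≡.trans (p n) (q n) }
                ; ∙-cong = λ p q n → ≡.cong₂ _⊕_ (p n) (q n) }
              ; assoc = λ f g h n → ⊕-assoc (f n) (g n) (h n) }
            ; identity = +-identityˡ , λ f n → ≡.trans (⊕-comm (f n) (const 0F n)) (+-identityˡ f n) }
          ; inverse = -‿inverseˡ , (λ f n → ≡.trans (⊕-comm (f n) (⊖ f n)) (-‿inverseˡ f n))
          ; ⁻¹-cong = λ p n → ≡.cong ⊖_ (p n) }
        ; comm = λ f g n → ⊕-comm (f n) (g n) }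
      ; *-cong = *ˢ-cong
      ; *-assoc = *ˢ-assoc
      ; *-identity = *-identityˡ , λ f n → ≡.trans (*ˢ-comm f (const 1F) n) (*-identityˡ f n)
      ; distrib = (λ f g h n → ≡.trans (*ˢ-comm f (g +ˢ h) n) (≡.trans (*ˢ-distribʳ f g h n)
                    (≡.cong₂ _⊕_ (*ˢ-comm g f n) (*ˢ-comm h f n))))
                , *ˢ-distribʳ
      }
    ; *-comm = *ˢ-comm
    }
  }
  where
  const-0F : ∀ n → const 0F n ≡ 0F
  const-0F zero    = ≡.refl
  const-0F (suc n) = ≡.refl
  +-identityˡ : ∀ f → const 0F +ˢ f ≗ f
  +-identityˡ f n = ≡.trans (≡.cong (_⊕ f n) (const-0F n)) (⊕-identityˡ (f n))
  -‿inverseˡ : ∀ f → (-ˢ f) +ˢ f ≗ const 0F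
  -‿inverseˡ f n = ≡.trans (⊖-inverseˡ (f n)) (≡.sym (const-0F n))
  *-identityˡ : ∀ f → const 1F *ˢ f ≗ f
  *-identityˡ f n = ≡.trans (const-*ˢ 1F f n) (⊗-identityˡ (f n))

constants : F₅-rawRing -Raw-AlmostCommutative⟶ fromCommutativeRing seriesRing
constants = record
  { ⟦_⟧    = const
  ; +-homo = λ { c d zero → ≡.refl ; c d (suc n) → ≡.refl }
  ; *-homo = λ { c d zero → ≡.refl ; c d (suc n) → ≡.sym (≡.trans (const-*ˢ c (const d) (suc n)) (F.zeroʳ c)) }
  ; -‿homo = λ { c zero → ≡.refl ; c (suc n) → ≡.refl }
  ; 0-homo = λ _ → ≡.refl
  ; 1-homo = λ _ → ≡.refl
  }

module _ where

  open CommutativeRing seriesRing hiding (zero)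
  open import Algebra.Properties.Semiring.Exp semiring
  open F₅Algebra seriesRing constants
  open _-Raw-AlmostCommutative⟶_ constants using (*-homo)
  import Algebra.Properties.CommutativeSemigroup *-commutativeSemigroup as *

  shift : Series → Series
  shift f zero    = 0F
  shift f (suc n) = f n

  q : Series
  q = shift (const 1F)

  open Products q

  q-* : ∀ f → q * f ≈ shift f
  q-* f zero    = F.zeroˡ (f 0)
  q-* f (suc n) = ≡.trans (≡.cong₂ _⊕_ (F.zeroˡ (f (suc n))) (*-identityˡ f n)) (⊕-identityˡ (f n))

  shift-cong : ∀ {f g} → f ≈ g → shift f ≈ shift g
  shift-cong p zero    = ≡.refl
  shift-cong p (suc n) = p n

  q^-*-suc : ∀ k f → q ^ suc k * f ≈ shift (q ^ k * f)
  q^-*-suc k f = trans (*-assoc q (q ^ k) f) (q-* (q ^ k * f))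

  q^-*-≥ : ∀ k f n → (q ^ k * f) (k ℕ.+ n) ≡ f n
  q^-*-≥ zero    f n = *-identityˡ f n
  q^-*-≥ (suc k) f n = ≡.trans (q^-*-suc k f (suc k ℕ.+ n)) (q^-*-≥ k f n)

  q^-*-< : ∀ k f {n} → n ℕ.< k → (q ^ k * f) n ≡ 0F
  q^-*-< (suc k) f {zero}  _           = q^-*-suc k f 0
  q^-*-< (suc k) f {suc n} (ℕ.s≤s n<k) = ≡.trans (q^-*-suc k f (suc n)) (q^-*-< k f n<k)

  q^-≥ : ∀ k n → (q ^ k) (k ℕ.+ n) ≡ const 1F n
  q^-≥ k n = ≡.trans (≡.sym (*-identityʳ (q ^ k) (k ℕ.+ n))) (q^-*-≥ k 1# n)

  q^-< : ∀ k {n} → n ℕ.< k → (q ^ k) n ≡ 0F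
  q^-< k n<k = ≡.trans (≡.sym (*-identityʳ (q ^ k) _)) (q^-*-< k 1# n<k)

  -- The operator U and the substitution V of q⁵ for q

  U V : Series → Series
  U f n = f (n ℕ.* 5)
  V f zero                                = f 0
  V f (suc zero)                          = 0F
  V f (suc (suc zero))                    = 0F
  V f (suc (suc (suc zero)))              = 0F
  V f (suc (suc (suc (suc zero))))        = 0F
  V f (suc (suc (suc (suc (suc n)))))     = V (f ∘ suc) n

  U-V : ∀ f → U (V f) ≈ f
  U-V f zero    = ≡.refl
  U-V f (suc n) = U-V (f ∘ suc) n

  V-∤ : ∀ f n (r : Fin 4) → V f (suc (toℕ r) ℕ.+ n ℕ.* 5) ≡ 0F
  V-∤ f zero 0F = ≡.refl
  V-∤ f zero 1F = ≡.refl
  V-∤ f zero 2F = ≡.refl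
  V-∤ f zero 3F = ≡.refl
  V-∤ f (suc n) 0F = V-∤ (f ∘ suc) n 0F
  V-∤ f (suc n) 1F = V-∤ (f ∘ suc) n 1F
  V-∤ f (suc n) 2F = V-∤ (f ∘ suc) n 2F
  V-∤ f (suc n) 3F = V-∤ (f ∘ suc) n 3F

  const-+-q : ∀ f → f ≈ const (f 0) + q * (f ∘ suc)
  const-+-q f zero    = ≡.sym (F.+-identityʳ (f 0))
  const-+-q f (suc n) = ≡.sym (≡.trans (⊕-identityˡ ((q * (f ∘ suc)) (suc n))) (q-* (f ∘ suc) (suc n)))

  -- Frobenius applied to f = f 0 + q (f ∘ suc). Read coefficientwise, this is the recursion that
  -- defines V.
  ^5-split : ∀ f → f ^ 5 ≈ const (f 0) + q ^ 5 * (f ∘ suc) ^ 5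
  ^5-split f = trans (^-congˡ 5 (const-+-q f)) (trans (frobenius-+ _ _)
    (+-cong (frobenius-constant (f 0)) (frobenius-* q (f ∘ suc))))

  ^5-split-< : ∀ f {n} → suc n ℕ.< 5 → (f ^ 5) (suc n) ≡ 0F
  ^5-split-< f {n} n<5 = ≡.trans (^5-split f (suc n)) (≡.cong (0F ⊕_) (q^-*-< 5 ((f ∘ suc) ^ 5) n<5))

  ^5≈V : ∀ f → f ^ 5 ≈ V f
  ^5≈V f 0 = ≡.trans (^5-split f 0) (≡.trans (≡.cong (f 0 ⊕_) (q^-*-< 5 ((f ∘ suc) ^ 5) (ℕ.s≤s ℕ.z≤n))) (F.+-identityʳ (f 0)))
  ^5≈V f 1 = ^5-split-< f (ℕ.s≤s (ℕ.s≤s ℕ.z≤n))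
  ^5≈V f 2 = ^5-split-< f (ℕ.s≤s (ℕ.s≤s (ℕ.s≤s ℕ.z≤n)))
  ^5≈V f 3 = ^5-split-< f (ℕ.s≤s (ℕ.s≤s (ℕ.s≤s (ℕ.s≤s ℕ.z≤n))))
  ^5≈V f 4 = ^5-split-< f (ℕ.s≤s (ℕ.s≤s (ℕ.s≤s (ℕ.s≤s (ℕ.s≤s ℕ.z≤n)))))
  ^5≈V f (suc (suc (suc (suc (suc n))))) = begin
    (f ^ 5) (5 ℕ.+ n)                                  ≡⟨ ^5-split f (5 ℕ.+ n) ⟩
    0F ⊕ (q ^ 5 * (f ∘ suc) ^ 5) (5 ℕ.+ n)             ≡⟨ ⊕-identityˡ ((q ^ 5 * (f ∘ suc) ^ 5) (5 ℕ.+ n)) ⟩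
    (q ^ 5 * (f ∘ suc) ^ 5) (5 ℕ.+ n)                  ≡⟨ q^-*-≥ 5 ((f ∘ suc) ^ 5) n ⟩
    ((f ∘ suc) ^ 5) n                                  ≡⟨ ^5≈V (f ∘ suc) n ⟩
    V (f ∘ suc) n                                      ∎
    where open ≡.≡-Reasoning

  ^5-*-split : ∀ f g → f ^ 5 * g ≈ f 0 ·ˢ g + q ^ 5 * ((f ∘ suc) ^ 5 * g)
  ^5-*-split f g = trans (*-congʳ (^5-split f)) (trans (distribʳ g _ _)
    (+-cong (const-*ˢ (f 0) g) (*-assoc (q ^ 5) _ g)))

  -- U turns the factor q⁵ in `^5-*-split` into q, which reproduces the recursion defining the
  -- product with `U g`.
  U-^5-* : ∀ f g → U (f ^ 5 * g) ≈ f * U g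
  U-^5-* f g zero = ≡.trans (^5-*-split f g 0) (≡.trans
    (≡.cong (f 0 ⊗ g 0 ⊕_) (q^-*-< 5 ((f ∘ suc) ^ 5 * g) (ℕ.s≤s ℕ.z≤n))) (F.+-identityʳ (f 0 ⊗ g 0)))
  U-^5-* f g (suc n) = ≡.trans (^5-*-split f g (5 ℕ.+ n ℕ.* 5)) (≡.cong (f 0 ⊗ U g (suc n) ⊕_)
    (≡.trans (q^-*-≥ 5 ((f ∘ suc) ^ 5 * g) (n ℕ.* 5)) (U-^5-* (f ∘ suc) g n)))

  U-1 : U (const 1F) ≈ const 1F
  U-1 zero    = ≡.refl
  U-1 (suc n) = ≡.refl

  U-q : ∀ (r : Fin 4) → U (q ^ suc (toℕ r)) ≈ const 0F
  U-q r zero = q^-< (suc (toℕ r)) (ℕ.s≤s ℕ.z≤n)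
  U-q 0F (suc n) = q^-≥ 1 (4 ℕ.+ n ℕ.* 5)
  U-q 1F (suc n) = q^-≥ 2 (3 ℕ.+ n ℕ.* 5)
  U-q 2F (suc n) = q^-≥ 3 (2 ℕ.+ n ℕ.* 5)
  U-q 3F (suc n) = q^-≥ 4 (1 ℕ.+ n ℕ.* 5)

  section : ℕ → Series → Series
  section r f n = f (r ℕ.+ n ℕ.* 5)

  dissect : ∀ f → (∀ n → section 2 f n ≡ 0F) → (∀ n → section 3 f n ≡ 0F) →
    f ≈ V (U f) + shift (V (section 1 f)) + shift (shift (shift (shift (V (section 4 f)))))
  dissect f f₂ f₃ 0 = ≡.sym (≡.trans (F.+-identityʳ (f 0 ⊕ 0F)) (F.+-identityʳ (f 0)))
  dissect f f₂ f₃ 1 = ≡.sym (≡.trans (F.+-identityʳ (0F ⊕ f 1)) (⊕-identityˡ (f 1)))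
  dissect f f₂ f₃ 2 = f₂ 0
  dissect f f₂ f₃ 3 = f₃ 0
  dissect f f₂ f₃ 4 = ≡.sym (⊕-identityˡ (f 4))
  dissect f f₂ f₃ (suc (suc (suc (suc (suc n))))) =
    ≡.trans (dissect (λ n → f (5 ℕ.+ n)) (f₂ ∘ suc) (f₃ ∘ suc) n)
      (≡.cong₂ _⊕_ (≡.cong (V (U f ∘ suc) n ⊕_) (shift₁ n)) (shift₄ n))
    where
    shift₁ : ∀ n → shift (V (section 1 f ∘ suc)) n ≡ V (section 1 f) (4 ℕ.+ n)
    shift₁ zero    = ≡.refl
    shift₁ (suc n) = ≡.refl
    shift₄ : ∀ n → shift (shift (shift (shift (V (section 4 f ∘ suc))))) n ≡ V (section 4 f) (1 ℕ.+ n)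
    shift₄ 0 = ≡.refl
    shift₄ 1 = ≡.refl
    shift₄ 2 = ≡.refl
    shift₄ 3 = ≡.refl
    shift₄ (suc (suc (suc (suc n)))) = ≡.refl

  *-q⁴ : ∀ f → f * q ^ 4 ≈ shift (shift (shift (shift f)))
  *-q⁴ f = trans (*-comm f (q ^ 4)) (trans (q^-*-suc 3 f) (shift-cong (trans (q^-*-suc 2 f)
    (shift-cong (trans (q^-*-suc 1 f) (shift-cong (trans (q^-*-suc 0 f) (shift-cong (*-identityˡ f)))))))))

  -- Congruence modulo a power of q

  infix 4 _≈[_]_
  _≈[_]_ : Series → ℕ → Series → Set
  f ≈[ N ] g = ∀ n → n ℕ.< N → f n ≡ g n

  *-cong-≈[] : ∀ {N f f′ g g′} → f ≈[ N ] f′ → g ≈[ N ] g′ → f * g ≈[ N ] f′ * g′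
  *-cong-≈[] p q n n<N = *ˢ-cong≤ n (λ i i≤n → p i (ℕ.≤-<-trans i≤n n<N)) (λ i i≤n → q i (ℕ.≤-<-trans i≤n n<N))

  ^-cong-≈[] : ∀ {N f g} k → f ≈[ N ] g → f ^ k ≈[ N ] g ^ k
  ^-cong-≈[] zero    p n _ = ≡.refl
  ^-cong-≈[] (suc k) p     = *-cong-≈[] p (^-cong-≈[] k p)

  -- Division by f, one coefficient at a time: the constant terms of g and h agree, and removing
  -- their contribution by `*ˢ-suc` leaves the same problem for the tails.
  *-cancelˡ-≈[] : ∀ N f g h → f 0 ≡ 1F → f * g ≈[ N ] f * h → g ≈[ N ] h
  *-cancelˡ-≈[] (suc N) f g h f₀ eq = go
    where
    open ≡.≡-Reasoning
    g₀≡h₀ : g 0 ≡ h 0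
    g₀≡h₀ = begin
      g 0        ≡⟨ ⊗-identityˡ (g 0) ⟨
      1F ⊗ g 0   ≡⟨ ≡.cong (_⊗ g 0) f₀ ⟨
      f 0 ⊗ g 0  ≡⟨ eq 0 (ℕ.s≤s ℕ.z≤n) ⟩
      f 0 ⊗ h 0  ≡⟨ ≡.cong (_⊗ h 0) f₀ ⟩
      1F ⊗ h 0   ≡⟨ ⊗-identityˡ (h 0) ⟩
      h 0        ∎
    eq-suc : f * (g ∘ suc) ≈[ N ] f * (h ∘ suc)
    eq-suc n n<N = ∙-cancelʳ (f (suc n) ⊗ h 0) _ _ (begin
      (f * (g ∘ suc)) n ⊕ f (suc n) ⊗ h 0  ≡⟨ ≡.cong (λ x → (f * (g ∘ suc)) n ⊕ f (suc n) ⊗ x) g₀≡h₀ ⟨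
      (f * (g ∘ suc)) n ⊕ f (suc n) ⊗ g 0  ≡⟨ *ˢ-suc f g n ⟨
      (f * g) (suc n)                      ≡⟨ eq (suc n) (ℕ.s≤s n<N) ⟩
      (f * h) (suc n)                      ≡⟨ *ˢ-suc f h n ⟩
      (f * (h ∘ suc)) n ⊕ f (suc n) ⊗ h 0  ∎)
    go : g ≈[ suc N ] h
    go zero    _           = g₀≡h₀
    go (suc n) (ℕ.s≤s n<N) = *-cancelˡ-≈[] N f (g ∘ suc) (h ∘ suc) f₀ eq-suc n n<N

  -- The theta series φ and its coefficients

  ι : ℕ → F₅
  ι zero    = 0F
  ι (suc n) = 1F ⊕ ι n

  ι-+ : ∀ m n → ι (m ℕ.+ n) ≡ ι m ⊕ ι n
  ι-+ zero    n = ≡.sym (⊕-identityˡ (ι n))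
  ι-+ (suc m) n = ≡.trans (≡.cong (1F ⊕_) (ι-+ m n)) (≡.sym (⊕-assoc 1F (ι m) (ι n)))

  sgn : ℕ → F₅
  sgn zero    = 1F
  sgn (suc n) = 4F ⊗ sgn n

  sgn-+ : ∀ m n → sgn (m ℕ.+ n) ≡ sgn m ⊗ sgn n
  sgn-+ zero    n = ≡.sym (⊗-identityˡ (sgn n))
  sgn-+ (suc m) n = ≡.trans (≡.cong (4F ⊗_) (sgn-+ m n)) (≡.sym (⊗-assoc 4F (sgn m) (sgn n)))

  sgn-*5 : ∀ n → sgn (n ℕ.* 5) ≡ sgn n
  sgn-*5 zero    = ≡.refl
  sgn-*5 (suc n) = ≡.trans (4⁵≡4 (sgn (n ℕ.* 5))) (≡.cong (4F ⊗_) (sgn-*5 n))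
    where
    4⁵≡4 : ∀ x → 4F ⊗ (4F ⊗ (4F ⊗ (4F ⊗ (4F ⊗ x)))) ≡ 4F ⊗ x
    4⁵≡4 = from-yes (all? λ x → 4F ⊗ (4F ⊗ (4F ⊗ (4F ⊗ (4F ⊗ x)))) ≟ 4F ⊗ x)

  sgn-double : ∀ n → sgn n ⊗ sgn n ≡ 1F
  sgn-double zero    = ≡.refl
  sgn-double (suc n) = ≡.trans (4²≡1 (sgn n)) (sgn-double n)
    where
    4²≡1 : ∀ x → (4F ⊗ x) ⊗ (4F ⊗ x) ≡ x ⊗ x
    4²≡1 = from-yes (all? λ x → (4F ⊗ x) ⊗ (4F ⊗ x) ≟ x ⊗ x)

  sgn-square : ∀ n → sgn (n ℕ.* n) ≡ sgn n
  sgn-square zero    = ≡.refl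
  sgn-square (suc n) = ≡.cong (4F ⊗_) (begin
    sgn (n ℕ.+ n ℕ.* suc n)              ≡⟨ ≡.cong (λ k → sgn (n ℕ.+ k)) (ℕ.*-suc n n) ⟩
    sgn (n ℕ.+ (n ℕ.+ n ℕ.* n))          ≡⟨ ≡.cong sgn (ℕ.+-assoc n n (n ℕ.* n)) ⟨
    sgn (n ℕ.+ n ℕ.+ n ℕ.* n)            ≡⟨ sgn-+ (n ℕ.+ n) (n ℕ.* n) ⟩
    sgn (n ℕ.+ n) ⊗ sgn (n ℕ.* n)        ≡⟨ ≡.cong₂ _⊗_ (≡.trans (sgn-+ n n) (sgn-double n)) (sgn-square n) ⟩
    1F ⊗ sgn n                           ≡⟨ ⊗-identityˡ (sgn n) ⟩
    sgn n                                ∎)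
    where open ≡.≡-Reasoning

  sign≈sgn : ∀ n → sign n ≈ const (sgn n)
  sign≈sgn zero    = refl
  sign≈sgn (suc n) = trans (*-congˡ {const 4F} (sign≈sgn n)) (sym (*-homo 4F (sgn n)))

  -- The monomial (-q)ᵐ.
  term : ℕ → Series
  term m = const (sgn m) * q ^ m

  term-* : ∀ m n → term m * term n ≈ term (m ℕ.+ n)
  term-* m n = trans (*.interchange (const (sgn m)) (q ^ m) (const (sgn n)) (q ^ n)) (*-cong
    (trans (sym (*-homo (sgn m) (sgn n))) (reflexive (≡.cong const (≡.sym (sgn-+ m n)))))
    (sym (^-homo-* q m n)))

  q^-≢ : ∀ {m n} → ¬ m ≡ n → (q ^ m) n ≡ 0F
  q^-≢ {m} {n} m≢n with n ℕ.<? m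
  ... | yes n<m = q^-< m n<m
  ... | no n≮m with ℕ.m≤n⇒∃[o]m+o≡n (ℕ.≮⇒≥ n≮m)
  ...   | zero , ≡.refl = contradiction (≡.sym (ℕ.+-identityʳ m)) m≢n
  ...   | suc k , ≡.refl = q^-≥ m (suc k)

  term-≡ : ∀ m → term m m ≡ sgn m
  term-≡ m = begin
    term m m                ≡⟨ const-*ˢ (sgn m) (q ^ m) m ⟩
    sgn m ⊗ (q ^ m) m       ≡⟨ ≡.cong (λ k → sgn m ⊗ (q ^ m) k) (ℕ.+-identityʳ m) ⟨
    sgn m ⊗ (q ^ m) (m ℕ.+ 0)  ≡⟨ ≡.cong (sgn m ⊗_) (q^-≥ m 0) ⟩
    sgn m ⊗ 1F              ≡⟨ F.*-identityʳ (sgn m) ⟩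
    sgn m                   ∎
    where open ≡.≡-Reasoning

  term-≢ : ∀ {m n} → ¬ m ≡ n → term m n ≡ 0F
  term-≢ {m} {n} m≢n = ≡.trans (const-*ˢ (sgn m) (q ^ m) n)
    (≡.trans (≡.cong (sgn m ⊗_) (q^-≢ m≢n)) (F.zeroʳ (sgn m)))

  module _ {I : Set} where

    gen : (I → ℕ) → List I → Series
    gen w []       = const 0F
    gen w (i ∷ xs) = term (w i) + gen w xs

    gen-coefficient : ∀ (w : I → ℕ) xs n → gen w xs n ≡ sgn n ⊗ ι (count (λ i → w i ℕ.≟ n) xs)
    gen-coefficient w [] zero    = ≡.refl
    gen-coefficient w [] (suc n) = ≡.sym (F.zeroʳ (sgn (suc n)))
    gen-coefficient w (i ∷ xs) n with w i ℕ.≟ n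
    ... | yes ≡.refl = begin
      term (w i) (w i) ⊕ gen w xs (w i)
        ≡⟨ ≡.cong₂ _⊕_ (≡.trans (term-≡ (w i)) (≡.sym (F.*-identityʳ (sgn (w i))))) (gen-coefficient w xs (w i)) ⟩
      sgn (w i) ⊗ 1F ⊕ sgn (w i) ⊗ ι (count w≟ xs)
        ≡⟨ ⊗-distribˡ-⊕ (sgn (w i)) 1F (ι (count w≟ xs)) ⟨
      sgn (w i) ⊗ ι (suc (count w≟ xs))
        ≡⟨ ≡.cong (λ k → sgn (w i) ⊗ ι k) (≡.cong length (filter-accept w≟ {i} {xs} ≡.refl)) ⟨
      sgn (w i) ⊗ ι (count w≟ (i ∷ xs)) ∎
      where
      open ≡.≡-Reasoning
      w≟ = λ j → w j ℕ.≟ w i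
    ... | no wᵢ≢n = begin
      term (w i) n ⊕ gen w xs n
        ≡⟨ ≡.cong₂ _⊕_ (term-≢ wᵢ≢n) (gen-coefficient w xs n) ⟩
      0F ⊕ sgn n ⊗ ι (count w≟ xs)
        ≡⟨ ⊕-identityˡ (sgn n ⊗ ι (count w≟ xs)) ⟩
      sgn n ⊗ ι (count w≟ xs)
        ≡⟨ ≡.cong (λ k → sgn n ⊗ ι k) (≡.cong length (filter-reject w≟ {i} {xs} wᵢ≢n)) ⟨
      sgn n ⊗ ι (count w≟ (i ∷ xs)) ∎
      where
      open ≡.≡-Reasoning
      w≟ = λ j → w j ℕ.≟ n

    gen-++ : ∀ w (xs ys : List I) → gen w (xs ++ ys) ≈ gen w xs + gen w ys
    gen-++ w []       ys = sym (+-identityˡ (gen w ys))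
    gen-++ w (x ∷ xs) ys = trans (+-congˡ {term (w x)} (gen-++ w xs ys))
      (sym (+-assoc (term (w x)) (gen w xs) (gen w ys)))

  module _ {I J : Set} (v : I → ℕ) (w : J → ℕ) (u : I × J → ℕ) (u≡ : ∀ i j → u (i , j) ≡ v i ℕ.+ w j) where

    gen-map : ∀ i ys → gen u (map (i ,_) ys) ≈ term (v i) * gen w ys
    gen-map i []       = sym (zeroʳ (term (v i)))
    gen-map i (j ∷ ys) = trans
      (+-cong (trans (reflexive (≡.cong term (u≡ i j))) (sym (term-* (v i) (w j)))) (gen-map i ys))
      (sym (distribˡ (term (v i)) (term (w j)) (gen w ys)))

    gen-cartesianProduct : ∀ xs ys → gen u (cartesianProduct xs ys) ≈ gen v xs * gen w ys
    gen-cartesianProduct []       ys = sym (zeroˡ (gen w ys))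
    gen-cartesianProduct (i ∷ xs) ys = trans (gen-++ u (map (i ,_) ys) (cartesianProduct xs ys))
      (trans (+-cong (gen-map i ys) (gen-cartesianProduct xs ys))
        (sym (distribʳ (gen w ys) (term (v i)) (gen v xs))))

  theta : ℕ → Series
  theta N = gen square (ints N)

  -- The diagonal of the partial sums: x² = n forces x to lie between -n and n, so the coefficient
  -- at n no longer changes beyond `theta n`.
  φ : Series
  φ n = theta n n

  theta-suc : ∀ N → theta N ≈[ suc N ] theta (suc N)
  theta-suc N n n≤N = ≡.sym (begin
    t ⊕ (t ⊕ theta N n)    ≡⟨ ≡.cong (λ x → x ⊕ (x ⊕ theta N n)) (term-≢ K²≢n) ⟩
    0F ⊕ (0F ⊕ theta N n)  ≡⟨ ≡.trans (⊕-identityˡ (0F ⊕ theta N n)) (⊕-identityˡ (theta N n)) ⟩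
    theta N n              ∎)
    where
    open ≡.≡-Reasoning
    t = term (suc N ℕ.* suc N) n
    K²≢n : ¬ suc N ℕ.* suc N ≡ n
    K²≢n ≡.refl = ℕ.<⇒≱ n≤N (ℕ.m≤m*n (suc N) (suc N))

  φ≡theta : ∀ {n N} → n ℕ.≤′ N → φ n ≡ theta N n
  φ≡theta ℕ.≤′-refl = ≡.refl
  φ≡theta (ℕ.≤′-step n≤N) = ≡.trans (φ≡theta n≤N) (theta-suc _ _ (ℕ.s≤s (ℕ.≤′⇒≤ n≤N)))

  φ≈theta : ∀ {N} → φ ≈[ suc N ] theta N
  φ≈theta n (ℕ.s≤s n≤N) = φ≡theta (ℕ.≤⇒≤′ n≤N)

  -- The link between the two faces of φ: lattice-point counts on the left, the product identity on
  -- the right.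
  theta≈gaussSum : ∀ N → theta N ≈ gaussSum N
  theta≈gaussSum zero    = trans (+-identityʳ (term 0)) (*-identityˡ 1#)
  theta≈gaussSum (suc N) = begin
    t + (t + theta N)          ≈⟨ +-assoc t t (theta N) ⟨
    (t + t) + theta N          ≈⟨ +-comm (t + t) (theta N) ⟩
    theta N + (t + t)          ≈⟨ +-cong (theta≈gaussSum N) (double t) ⟩
    gaussSum N + const 2F * t  ≈⟨ +-congˡ {gaussSum N} (*-congˡ {const 2F} (*-congʳ {q ^ (suc N ℕ.* suc N)} sgn≈sign)) ⟩
    gaussSum (suc N)           ∎
    where
    open import Relation.Binary.Reasoning.Setoid setoid
    t = term (suc N ℕ.* suc N)
    double : ∀ f → f + f ≈ const 2F * f
    double f n = ≡.trans (from-yes (all? λ x → x ⊕ x ≟ 2F ⊗ x) (f n)) (≡.sym (const-*ˢ 2F f n))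
    sgn≈sign : const (sgn (suc N ℕ.* suc N)) ≈ sign (suc N)
    sgn≈sign = trans (reflexive (≡.cong const (sgn-square (suc N)))) (sym (sign≈sgn (suc N)))

  φ-coefficient : ∀ n N → n ℕ.≤ N → φ n ≡ sgn n ⊗ ι (count (square≟ n) (ints N))
  φ-coefficient n N n≤N = ≡.trans (φ≈theta n (ℕ.s≤s n≤N)) (gen-coefficient square (ints N) n)

  φ²-coefficient : ∀ n N → n ℕ.≤ N → (φ * φ) n ≡ sgn n ⊗ ι (count (norm≟ n) (box N))
  φ²-coefficient n N n≤N = begin
    (φ * φ) n                             ≡⟨ *-cong-≈[] φ≈theta φ≈theta n (ℕ.s≤s n≤N) ⟩
    (theta N * theta N) n                 ≡⟨ gen-cartesianProduct square square norm (λ _ _ → ≡.refl) (ints N) (ints N) n ⟨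
    gen norm (box N) n                    ≡⟨ gen-coefficient norm (box N) n ⟩
    sgn n ⊗ ι (count (norm≟ n) (box N))   ∎
    where open ≡.≡-Reasoning

  data Residue₅ : ℕ → Set where
    multiple    : ∀ m → Residue₅ (m ℕ.* 5)
    nonmultiple : ∀ m (r : Fin 4) → Residue₅ (suc (toℕ r) ℕ.+ m ℕ.* 5)

  residue₅ : ∀ n → Residue₅ n
  residue₅ 0 = multiple 0
  residue₅ 1 = nonmultiple 0 0F
  residue₅ 2 = nonmultiple 0 1F
  residue₅ 3 = nonmultiple 0 2F
  residue₅ 4 = nonmultiple 0 3F
  residue₅ (suc (suc (suc (suc (suc n))))) with residue₅ n
  ... | multiple m       = multiple (suc m)
  ... | nonmultiple m 0F = nonmultiple (suc m) 0F
  ... | nonmultiple m 1F = nonmultiple (suc m) 1F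
  ... | nonmultiple m 2F = nonmultiple (suc m) 2F
  ... | nonmultiple m 3F = nonmultiple (suc m) 3F

  nonmultiple-∤ : ∀ m (r : Fin 4) → ¬ 5 ∣ suc (toℕ r) ℕ.+ m ℕ.* 5
  nonmultiple-∤ m r d = >⇒∤ (ℕ.s≤s (toℕ<n r))
    (∣m+n∣m⇒∣n (≡.subst (5 ∣_) (ℕ.+-comm (suc (toℕ r)) (m ℕ.* 5)) d) (n∣m*n m))

  vanish : ∀ n c → c ≡ 0 → sgn n ⊗ ι c ≡ 0F
  vanish n .0 ≡.refl = F.zeroʳ (sgn n)

  -- A square divisible by 5 is 25 times a square, and 25 is odd. So the coefficient of φ at 5 n is
  -- that at m when n = 5 m, and zero when 5 does not divide n, as in φ(q⁵).
  U-φ : U φ ≈ φ ^ 5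
  U-φ n = ≡.trans (lemma n (residue₅ n)) (≡.sym (^5≈V φ n))
    where
    lemma : ∀ n → Residue₅ n → φ (n ℕ.* 5) ≡ V φ n
    lemma n (multiple m) = begin
      φ (m ℕ.* 5 ℕ.* 5)
        ≡⟨ φ-coefficient (m ℕ.* 5 ℕ.* 5) (m ℕ.* 5 ℕ.* 5) ℕ.≤-refl ⟩
      sgn (m ℕ.* 5 ℕ.* 5) ⊗ ι (count (square≟ (m ℕ.* 5 ℕ.* 5)) (ints (m ℕ.* 5 ℕ.* 5)))
        ≡⟨ ≡.cong₂ (λ s c → s ⊗ ι c) (≡.trans (sgn-*5 (m ℕ.* 5)) (sgn-*5 m)) (≡.sym (count-square (m ℕ.* 5 ℕ.* 5) m ℕ.≤-refl)) ⟩
      sgn m ⊗ ι (count (square≟ m) (ints (m ℕ.* 5 ℕ.* 5)))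
        ≡⟨ φ-coefficient m (m ℕ.* 5 ℕ.* 5) (ℕ.≤-trans (ℕ.m≤m*n m 5) (ℕ.m≤m*n (m ℕ.* 5) 5)) ⟨
      φ m
        ≡⟨ U-V φ m ⟨
      V φ (m ℕ.* 5) ∎
      where open ≡.≡-Reasoning
    lemma n (nonmultiple m r) = ≡.trans (φ-coefficient (n ℕ.* 5) (n ℕ.* 5) ℕ.≤-refl)
      (≡.trans (vanish (n ℕ.* 5) (count (square≟ (n ℕ.* 5)) (ints (n ℕ.* 5))) (count-square-∤ (n ℕ.* 5) n (nonmultiple-∤ m r))) (≡.sym (V-∤ φ m r)))

  φ-nonresidue : ∀ r → NonresidueMod₅ r → ∀ n → section r φ n ≡ 0F
  φ-nonresidue r nonresidue n = ≡.trans (φ-coefficient (r ℕ.+ n ℕ.* 5) (r ℕ.+ n ℕ.* 5) ℕ.≤-refl)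
    (vanish (r ℕ.+ n ℕ.* 5) (count (square≟ (r ℕ.+ n ℕ.* 5)) (ints (r ℕ.+ n ℕ.* 5))) (count-square-nonresidue (r ℕ.+ n ℕ.* 5) r n nonresidue))

  -- `count-norm` read coefficientwise. Since 5 is odd the signs at n and 5 n agree, and the
  -- multiples of 2 + i of norm n number as many as the elements of norm n / 5, or none, which gives
  -- the coefficient of φ(q⁵)².
  U-φ² : U (φ * φ) + (φ * φ) ^ 5 ≈ const 2F * (φ * φ)
  U-φ² n = begin
    (φ * φ) (n ℕ.* 5) ⊕ ((φ * φ) ^ 5) n
      ≡⟨ ≡.cong₂ _⊕_ (≡.trans (φ²-coefficient (n ℕ.* 5) (n ℕ.* 5) ℕ.≤-refl) (≡.cong (_⊗ ι c₅) (sgn-*5 n)))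
                     (≡.trans (^5≈V (φ * φ) n) (lemma n (residue₅ n))) ⟩
    sgn n ⊗ ι c₅ ⊕ sgn n ⊗ ι c′
      ≡⟨ ⊗-distribˡ-⊕ (sgn n) (ι c₅) (ι c′) ⟨
    sgn n ⊗ (ι c₅ ⊕ ι c′)
      ≡⟨ ≡.cong (sgn n ⊗_) (ι-+ c₅ c′) ⟨
    sgn n ⊗ ι (c₅ ℕ.+ c′)
      ≡⟨ ≡.cong (λ k → sgn n ⊗ ι k) (count-norm (n ℕ.* 5) n ℕ.≤-refl) ⟩
    sgn n ⊗ ι (c ℕ.+ c)
      ≡⟨ ≡.cong (sgn n ⊗_) (ι-+ c c) ⟩
    sgn n ⊗ (ι c ⊕ ι c)
      ≡⟨ from-yes (all? λ x → all? λ y → x ⊗ (y ⊕ y) ≟ 2F ⊗ (x ⊗ y)) (sgn n) (ι c) ⟩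
    2F ⊗ (sgn n ⊗ ι c)
      ≡⟨ ≡.cong (2F ⊗_) (φ²-coefficient n (n ℕ.* 5) (ℕ.m≤m*n n 5)) ⟨
    2F ⊗ (φ * φ) n
      ≡⟨ const-*ˢ 2F (φ * φ) n ⟨
    (const 2F * (φ * φ)) n ∎
    where
    open ≡.≡-Reasoning
    c₅ c c′ : ℕ
    c₅ = count (norm≟ (n ℕ.* 5)) (box (n ℕ.* 5))
    c = count (norm≟ n) (box (n ℕ.* 5))
    c′ = count (normMult≟ n) (box (n ℕ.* 5))
    lemma : ∀ n → Residue₅ n → V (φ * φ) n ≡ sgn n ⊗ ι (count (normMult≟ n) (box (n ℕ.* 5)))
    lemma n (multiple m) = ≡.trans (U-V (φ * φ) m) (≡.trans (φ²-coefficient m (m ℕ.* 5 ℕ.* 5) (ℕ.≤-trans (ℕ.m≤m*n m 5) (ℕ.m≤m*n (m ℕ.* 5) 5)))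
      (≡.cong₂ (λ s k → s ⊗ ι k) (≡.sym (sgn-*5 m)) (count-mult (m ℕ.* 5 ℕ.* 5) m (ℕ.m≤m*n (m ℕ.* 5) 5))))
    lemma n (nonmultiple m r) = ≡.trans (V-∤ (φ * φ) m r)
      (≡.sym (vanish n (count (normMult≟ n) (box (n ℕ.* 5))) (count-mult-∤ (n ℕ.* 5) n (nonmultiple-∤ m r))))

  φ-split : φ ≈ (φ ^ 5) ^ 5 + section 1 φ ^ 5 * q + section 4 φ ^ 5 * q ^ 4
  φ-split = trans
    (dissect φ (φ-nonresidue 2 (from-yes (nonresidueMod₅? 2))) (φ-nonresidue 3 (from-yes (nonresidueMod₅? 3))))
    (+-cong (+-cong
      (trans (sym (^5≈V (U φ))) (^-congˡ 5 U-φ))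
      (trans (shift-cong (sym (^5≈V (section 1 φ)))) (sym (trans (*-comm (section 1 φ ^ 5) q) (q-* (section 1 φ ^ 5))))))
      (trans (shift-cong (shift-cong (shift-cong (shift-cong (sym (^5≈V (section 4 φ))))))) (sym (*-q⁴ (section 4 φ ^ 5)))))

  -- The generating function of overpartitions modulo 5

  toℕ-ι : ∀ n → toℕ (ι n) ≡ n ℕ.% 5
  toℕ-ι zero    = ≡.refl
  toℕ-ι (suc n) = begin
    toℕ (1F ⊕ ι n)                ≡⟨ toℕ-fromℕ< (ℕ.m%n<n (1 ℕ.+ toℕ (ι n)) 5) ⟩
    (1 ℕ.+ toℕ (ι n)) ℕ.% 5       ≡⟨ ≡.cong (λ k → (1 ℕ.+ k) ℕ.% 5) (toℕ-ι n) ⟩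
    (1 ℕ.+ n ℕ.% 5) ℕ.% 5         ≡⟨ ℕ.%-distribˡ-+ 1 n 5 ⟨
    suc n ℕ.% 5                   ∎
    where open ≡.≡-Reasoning

  overpartitions : Series
  overpartitions n = ι (Abar 125 n)

  partsUpTo : ℕ → Series
  partsUpTo k n = ι (partsCount 125 k n)

  overpartitions≈partsUpTo : ∀ {N} k → N ℕ.≤ suc k → overpartitions ≈[ N ] partsUpTo k
  overpartitions≈partsUpTo k N≤k n n<N =
    ≡.cong ι (partsCount-stable 125 (ℕ.≤⇒≤′ (ℕ.s≤s⁻¹ (ℕ.≤-trans n<N N≤k))))

  *-factor : ∀ f c k → f * factor c k ≈ f + c ·ˢ (q ^ k * f)
  *-factor f c k = begin
    f * (const 1F + const c * q ^ k)         ≈⟨ distribˡ f 1# (const c * q ^ k) ⟩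
    f * 1# + f * (const c * q ^ k)           ≈⟨ +-cong (*-identityʳ f) (*-comm f (const c * q ^ k)) ⟩
    f + const c * q ^ k * f                  ≈⟨ +-congˡ {f} (*-assoc (const c) (q ^ k) f) ⟩
    f + const c * (q ^ k * f)                ≈⟨ +-congˡ {f} (const-*ˢ c (q ^ k * f)) ⟩
    f + c ·ˢ (q ^ k * f)                     ∎
    where open import Relation.Binary.Reasoning.Setoid setoid

  partsUpTo-zero : partsUpTo 0 ≈ const 1F
  partsUpTo-zero zero    = ≡.refl
  partsUpTo-zero (suc n) = ≡.refl

  partsUpTo-∣ : ∀ k → 125 ∣ suc k → partsUpTo (suc k) ≈ partsUpTo k
  partsUpTo-∣ k d n = ≡.cong ι (partsCount-∣ 125 k n d)

  partsUpTo-∤ : ∀ k → ¬ 125 ∣ suc k → partsUpTo (suc k) * factor 4F (suc k) ≈ partsUpTo k * factor 1F (suc k)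
  partsUpTo-∤ k ∤d n = ≡.trans (*-factor (partsUpTo (suc k)) 4F (suc k) n)
    (≡.trans (lemma n) (≡.sym (*-factor (partsUpTo k) 1F (suc k) n)))
    where
    open ≡.≡-Reasoning
    K = suc k
    G = partsUpTo k
    G′ = partsUpTo (suc k)
    cancel : ∀ x y z → x ⊕ (y ⊕ z) ⊕ 4F ⊗ z ≡ x ⊕ 1F ⊗ y
    cancel = from-yes (all? λ x → all? λ y → all? λ z → x ⊕ (y ⊕ z) ⊕ 4F ⊗ z ≟ x ⊕ 1F ⊗ y)
    lemma : ∀ n → G′ n ⊕ 4F ⊗ (q ^ K * G′) n ≡ G n ⊕ 1F ⊗ (q ^ K * G) n
    lemma n with n ℕ.<? K
    ... | yes n<K = ≡.cong₂ _⊕_ (≡.cong ι (partsCount-< 125 k n n<K))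
      (≡.trans (≡.cong (4F ⊗_) (q^-*-< K G′ n<K)) (≡.sym (≡.cong (1F ⊗_) (q^-*-< K G n<K))))
    ... | no n≮K with ℕ.m≤n⇒∃[o]m+o≡n (ℕ.≮⇒≥ n≮K)
    ...   | m , ≡.refl = begin
      G′ (K ℕ.+ m) ⊕ 4F ⊗ (q ^ K * G′) (K ℕ.+ m)
        ≡⟨ ≡.cong₂ (λ x y → x ⊕ 4F ⊗ y) G′-+ (q^-*-≥ K G′ m) ⟩
      G (K ℕ.+ m) ⊕ (G m ⊕ G′ m) ⊕ 4F ⊗ G′ m
        ≡⟨ cancel (G (K ℕ.+ m)) (G m) (G′ m) ⟩
      G (K ℕ.+ m) ⊕ 1F ⊗ G m
        ≡⟨ ≡.cong (λ y → G (K ℕ.+ m) ⊕ 1F ⊗ y) (q^-*-≥ K G m) ⟨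
      G (K ℕ.+ m) ⊕ 1F ⊗ (q ^ K * G) (K ℕ.+ m) ∎
      where
      G′-+ : G′ (K ℕ.+ m) ≡ G (K ℕ.+ m) ⊕ (G m ⊕ G′ m)
      G′-+ = begin
        ι (partsCount 125 K (K ℕ.+ m))
          ≡⟨ ≡.cong ι (partsCount-+ 125 k m ∤d) ⟩
        ι (partsCount 125 k (K ℕ.+ m) ℕ.+ (partsCount 125 k m ℕ.+ partsCount 125 K m))
          ≡⟨ ι-+ (partsCount 125 k (K ℕ.+ m)) _ ⟩
        G (K ℕ.+ m) ⊕ ι (partsCount 125 k m ℕ.+ partsCount 125 K m)
          ≡⟨ ≡.cong (G (K ℕ.+ m) ⊕_) (ι-+ (partsCount 125 k m) (partsCount 125 K m)) ⟩
        G (K ℕ.+ m) ⊕ (G m ⊕ G′ m) ∎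

  ^-constantTerm : ∀ {f} → f 0 ≡ 1F → ∀ k → (f ^ k) 0 ≡ 1F
  ^-constantTerm f₀ zero    = ≡.refl
  ^-constantTerm f₀ (suc k) = ≡.cong₂ _⊗_ f₀ (^-constantTerm f₀ k)

  product-constantTerm : ∀ c L m → product c L m 0 ≡ 1F
  product-constantTerm c L zero    = ≡.refl
  product-constantTerm c L (suc m) = ≡.cong₂ _⊗_
    (≡.cong (1F ⊕_) (≡.trans (≡.cong (c ⊗_) (q^-< (suc L) (ℕ.s≤s ℕ.z≤n))) (F.zeroʳ c)))
    (product-constantTerm c (suc L) m)

  pow125-constantTerm : ∀ f → f 0 ≡ 1F → pow125 f 0 ≡ 1F
  pow125-constantTerm f f₀ = ^-constantTerm {(f ^ 5) ^ 5} (^-constantTerm {f ^ 5} (^-constantTerm {f} f₀ 5) 5) 5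

  φ≈gaussSum : ∀ {N} n → N ℕ.≤ suc n → φ ≈[ N ] gaussSum n
  φ≈gaussSum n N≤n i i<N = ≡.trans (φ≈theta {n} i (ℕ.≤-trans i<N N≤n)) (theta≈gaussSum n i)

  -- For the coefficient at M every series may be replaced modulo q^(M+1) by a finite version, with
  -- n = 125 M as the bound on the left and M on the right. `G-gaussSum` then gives the claim
  -- multiplied by W, which has constant term 1 and cancels.
  overpartitions-*-φ : overpartitions * φ ≈ pow125 φ
  overpartitions-*-φ M = at (M ℕ.* 125) ≡.refl
    where
    open ≡.≡-Reasoning
    at : ∀ n → n ≡ M ℕ.* 125 → (overpartitions * φ) M ≡ pow125 φ M
    at n n≡ = *-cancelˡ-≈[] (suc M) W (overpartitions * φ) (pow125 φ) W₀ eq M ℕ.≤-refl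
      where
      M≤n : suc M ℕ.≤ suc n
      M≤n = ℕ.s≤s (≡.subst (M ℕ.≤_) (≡.sym n≡) (ℕ.m≤m*n M 125))
      W = product 1F 0 n * pow125 (product 1F 0 M)
      W₀ : W 0 ≡ 1F
      W₀ = ≡.cong₂ _⊗_ (product-constantTerm 1F 0 n) (pow125-constantTerm (product 1F 0 M) (product-constantTerm 1F 0 M))
      identity = G-gaussSum partsUpTo partsUpTo-zero partsUpTo-∣ partsUpTo-∤ M n n≡
      r = proj₁ identity
      eq : W * (overpartitions * φ) ≈[ suc M ] W * pow125 φ
      eq i i≤M = begin
        (W * (overpartitions * φ)) i
          ≡⟨ *-comm W (overpartitions * φ) i ⟩
        (overpartitions * φ * W) i
          ≡⟨ *-cong-≈[] (*-cong-≈[] (overpartitions≈partsUpTo n M≤n) (φ≈gaussSum n M≤n)) (λ _ _ → ≡.refl) i i≤M ⟩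
        (partsUpTo n * gaussSum n * W) i
          ≡⟨ proj₂ identity i ⟩
        (pow125 (gaussSum M) * W) i ⊕ (q ^ suc M * r) i
          ≡⟨ ≡.cong ((pow125 (gaussSum M) * W) i ⊕_) (q^-*-< (suc M) r i≤M) ⟩
        (pow125 (gaussSum M) * W) i ⊕ 0F
          ≡⟨ F.+-identityʳ ((pow125 (gaussSum M) * W) i) ⟩
        (pow125 (gaussSum M) * W) i
          ≡⟨ *-comm (pow125 (gaussSum M)) W i ⟩
        (W * pow125 (gaussSum M)) i
          ≡⟨ *-cong-≈[] {g = pow125 φ} {g′ = pow125 (gaussSum M)} (λ _ _ → ≡.refl)
               (^-cong-≈[] 5 (^-cong-≈[] 5 (^-cong-≈[] 5 (φ≈gaussSum M ℕ.≤-refl)))) i i≤M ⟨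
        (W * pow125 φ) i ∎

  -- The factor φ is cancelled from φ¹²⁵ = φ φ¹²⁴; its constant term is 1.
  overpartitions≈φ¹²⁴ : overpartitions ≈ (((φ ^ 4) ^ 5) ^ 5 * (φ ^ 4) ^ 5) * φ ^ 4
  overpartitions≈φ¹²⁴ n = *-cancelˡ-≈[] (suc n) φ overpartitions _ ≡.refl
    (λ i _ → ≡.trans (*-comm φ overpartitions i) (≡.trans (overpartitions-*-φ i) (pow125-split φ i))) n ℕ.≤-refl

  overpartitions-U²≈U⁴ : U (U overpartitions) ≈ U (U (U (U overpartitions)))
  overpartitions-U²≈U⁴ = U²≈U⁴ φ (section 1 φ) (section 4 φ) φ-split U-φ² overpartitions overpartitions≈φ¹²⁴
    where open Descent q U (λ p n → p (n ℕ.* 5)) (λ _ _ _ → ≡.refl) U-^5-* U-1 U-q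

open import Data.Nat using (_*_; _%_)

theorem8 : (n : ℕ) → Abar 125 (25 * n) % 5 ≡ Abar 125 (625 * n) % 5
theorem8 n = begin
  Abar 125 (25 * n) % 5                 ≡⟨ ≡.cong (λ k → Abar 125 k % 5) 25*n≡ ⟩
  Abar 125 (n * 5 * 5) % 5              ≡⟨ toℕ-ι (Abar 125 (n * 5 * 5)) ⟨
  toℕ (U (U overpartitions) n)          ≡⟨ ≡.cong toℕ (overpartitions-U²≈U⁴ n) ⟩
  toℕ (U (U (U (U overpartitions))) n)  ≡⟨ toℕ-ι (Abar 125 (n * 5 * 5 * 5 * 5)) ⟩
  Abar 125 (n * 5 * 5 * 5 * 5) % 5      ≡⟨ ≡.cong (λ k → Abar 125 k % 5) 625*n≡ ⟨
  Abar 125 (625 * n) % 5                ∎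
  where
  open ≡.≡-Reasoning
  25*n≡ : 25 * n ≡ n * 5 * 5
  25*n≡ = ≡.trans (ℕ.*-comm 25 n) (≡.sym (ℕ.*-assoc n 5 5))
  625*n≡ : 625 * n ≡ n * 5 * 5 * 5 * 5
  625*n≡ = ≡.trans (ℕ.*-comm 625 n) (≡.trans (≡.sym (ℕ.*-assoc n 25 25))
    (≡.trans (≡.cong (_* 25) (≡.sym (ℕ.*-assoc n 5 5))) (≡.sym (ℕ.*-assoc (n * 5 * 5) 5 5))))
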